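{- Let $G=([n],E)$ be a chordal graph whose vertex ordering $1,2,\ldots,n$ is a perfect elimination ordering. Run Algorithm R on $G$ with initial elimination forest $F_0$, where $F_0$ is the elimination forest obtained by removing the vertices in the order $1,2,\ldots,n$. Then Algorithm R visits every elimination forest for $G$ exactly once.
   Context: For a graph $G$ and a vertex set $X$, $G-X$ is the graph obtained by deleting $X$. An elimination tree for a connected graph $G=(V,E)$ is a rooted tree on vertex set $V$ consisting of a root $x\in V$ whose children are the roots of elimination trees for the connected components of $G-x$ (children are unordered). An elimination forest for $G$ is a set of elimination trees, one for each connected component of $G$; $\mathcal{E}(G)$ is the set of all elimination forests. Removing vertices in an order (an elimination ordering) determines an elimination forest: the first removed vertex of a component is the root of its tree, and one recurses on the components that remain. A perfect elimination ordering of $G=([n],E)$ is the ordering $1,\ldots,n$ such that every vertex $v$ forms a clique together with its neighbors smaller than $v$. Rotation: let $T$ be an elimination tree in an elimination forest, $j$ a non-root vertex of $T$ with parent $i$, and $H$ the subgraph of $G$ induced by the vertices of the subtree of $T$ rooted at $i$. Rotating the edge $\{i,j\}$ yields the tree $T'$ in which $j$ takes the place of $i$ (it becomes the child of the former parent of $i$, or the root if $i$ was the root), $i$ becomes a child of $j$, all subtrees of $i$ remain subtrees of $i$, and each subtree $S$ of $j$ remains a subtree of $j$ unless the vertices of $S$ lie in the same connected component of $H-j$ as $i$, in which case $S$ becomes a subtree of $i$. A rotation in a forest is a rotation in one of its trees. For a vertex $j$, an up-rotation of $j$ is the rotation of the edge between $j$ and its parent $i$ when $i<j$; a down-rotation of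 $j$ is the rotation of an edge between $j$ and a child $i$ of $j$ with $i<j$. Algorithm R (input: graph $G=([n],E)$ and initial forest $F_0\in\mathcal{E}(G)$): visit $F_0$. Then repeat: in the most recently visited forest $F$, let $j$ be the largest vertex such that some up- or down-rotation of $j$ produces a forest that has not been visited yet. If no such $j$ exists, terminate. If there is more than one edge $\{i,j\}$ with $i<j$ whose rotation produces an unvisited forest, terminate. Otherwise, perform that rotation, visit the resulting forest, and repeat. -}

module Defs where

open import Data.Nat using (ℕ; _≤_; _%_; suc) renaming (_+_ to _+ℕ_)
open import Data.Bool using (Bool; true; false)
open import Data.Fin using (Fin; toℕ; _<_)
open import Data.Fin.Subset using (Subset; _∈_; _∉_; _⊆_; _-_; ⊤)
open import Data.Maybe using (Maybe; just; nothing)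
open import Data.List using (List; []; _∷_; length; lookup)
open import Data.List.Relation.Unary.All using (All)
open import Data.Product using (Σ; ∃; ∃-syntax; _×_; _,_)
open import Data.Sum using (_⊎_)
open import Relation.Nullary using (¬_)
open import Relation.Binary.PropositionalEquality using (_≡_; _≢_; _≗_)

-- Simple graphs on vertex set [n] = Fin n (vertex k ↔ toℕ k + 1)

record Graph (n : ℕ) : Set where
  field
    E      : Fin n → Fin n → Bool
    sym    : ∀ u v → E u v ≡ E v u
    irrefl : ∀ v → E v v ≡ false

module _ {n : ℕ} (G : Graph n) where
  open Graph G

  Adj : Fin n → Fin n → Set
  Adj u v = E u v ≡ true

  PerfectElimOrdering : Set
  PerfectElimOrdering = ∀ v u w → u < v → w < v → Adj u v → Adj w v → u ≢ w → Adj u w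

  Chordal : Set
  Chordal = ∀ (m : ℕ) → let k = 4 +ℕ m in (c : Fin k → Fin n)
          → (∀ a b → c a ≡ c b → a ≡ b)
          → (∀ a b → suc (toℕ a) % k ≡ toℕ b → Adj (c a) (c b))
          → ∃[ a ] ∃[ b ] (Adj (c a) (c b)
                           × ¬ (suc (toℕ a) % k ≡ toℕ b)
                           × ¬ (suc (toℕ b) % k ≡ toℕ a))

  data Reach (P : Fin n → Set) : Fin n → Fin n → Set where
    here : ∀ {v} → P v → Reach P v v
    step : ∀ {u w v} → P u → Adj u w → Reach P w v → Reach P u v

  IsComponent : Subset n → Subset n → Set
  IsComponent S C =
      C ⊆ S
    × (∃[ x ] x ∈ C)
    × (∀ u v → u ∈ C → v ∈ C → Reach (_∈ S) u v)
    × (∀ u v → u ∈ C → v ∈ S → Adj u v → v ∈ C)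

-- A forest on [n] is represented by its parent function (nothing = root).
-- Children are unordered, so this representation is canonical.
Forest : ℕ → Set
Forest n = Fin n → Maybe (Fin n)

module _ {n : ℕ} (G : Graph n) where

  -- IsEF par S q : par restricted to S is an elimination forest for G[S],
  -- where the roots of its trees have parent q (the paper's recursive definition:
  -- each component C of G[S] has a root x ∈ C whose children are the roots of
  -- elimination trees of the components of G[C] - x).
  data IsEF (par : Forest n) : Subset n → Maybe (Fin n) → Set where
    node : ∀ {S q}
         → (∀ C → IsComponent G S C
              → ∃[ x ] (x ∈ C × par x ≡ q × IsEF par (C - x) (just x)))
         → IsEF par S q

  ElimForest : Forest n → Set
  ElimForest par = IsEF par ⊤ nothing

  -- Forest obtained by removing the vertices in the order given by rank
  -- (smaller rank removed first): the root of each component is its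
  -- first removed vertex.
  data ByOrder (rank : Fin n → ℕ) (par : Forest n) : Subset n → Maybe (Fin n) → Set where
    node : ∀ {S q}
         → (∀ C → IsComponent G S C
              → ∃[ x ] (x ∈ C × (∀ y → y ∈ C → rank x ≤ rank y)
                        × par x ≡ q × ByOrder rank par (C - x) (just x)))
         → ByOrder rank par S q

  ForestOfOrdering : (Fin n → ℕ) → Forest n → Set
  ForestOfOrdering rank par = ByOrder rank par ⊤ nothing

  data Desc (par : Forest n) : Fin n → Fin n → Set where
    refl  : ∀ {v} → Desc par v v
    up    : ∀ {v w a} → par v ≡ just w → Desc par w a → Desc par v a

  Rot : Forest n → Fin n → Fin n → Forest n → Set
  Rot par i j par' =
      par j ≡ just i
    × par' j ≡ par i
    × par' i ≡ just j
    × (∀ c → par c ≡ just j →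
          (SameComp c → par' c ≡ just i) × (¬ SameComp c → par' c ≡ just j))
    × (∀ v → v ≢ i → v ≢ j → par v ≢ just j → par' v ≡ par v)
    where
      H-j : Fin n → Set
      H-j v = Desc par v i × v ≢ j
      SameComp : Fin n → Set
      SameComp c = ∀ v → Desc par v c → Reach G H-j v i

  Unvisited : List (Forest n) → Forest n → Set
  Unvisited vs F' = All (λ F → ¬ (F ≗ F')) vs

  -- In current forest F with visited list vs (F ∈ vs), rotating edge {i,j},
  -- i < j (an up- or down-rotation of j), yields the unvisited forest F'.
  Cand : List (Forest n) → Forest n → Fin n → Fin n → Forest n → Set
  Cand vs F j i F' = i < j × (Rot F i j F' ⊎ Rot F j i F') × Unvisited vs F'

  HasMove : List (Forest n) → Forest n → Fin n → Set
  HasMove vs F j = ∃[ i ] ∃[ F' ] Cand vs F j i F'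

  Largest : List (Forest n) → Forest n → Fin n → Set
  Largest vs F j = HasMove vs F j × (∀ j' → j < j' → ¬ HasMove vs F j')

  Step : Forest n → List (Forest n) → Forest n → Set
  Step F vs F' = ∃[ j ] ∃[ i ]
      ( Largest (F ∷ vs) F j
      × Cand (F ∷ vs) F j i F'
      × (∀ i' F'' → Cand (F ∷ vs) F j i' F'' → i' ≡ i))

  Halts : Forest n → List (Forest n) → Set
  Halts F vs =
      (∀ j → ¬ HasMove (F ∷ vs) F j)
    ⊎ (∃[ j ] (Largest (F ∷ vs) F j
        × ∃[ i ] ∃[ i' ] ∃[ F' ] ∃[ F'' ]
            (Cand (F ∷ vs) F j i F' × Cand (F ∷ vs) F j i' F'' × i ≢ i')))

  data Run (F₀ : Forest n) : Forest n → List (Forest n) → Set where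
    start : Run F₀ F₀ []
    step  : ∀ {F vs F'} → Run F₀ F vs → Step F vs F' → Run F₀ F' (F ∷ vs)

  VisitedExactlyOnce : List (Forest n) → Forest n → Set
  VisitedExactlyOnce L F =
    Σ (Fin (length L)) λ k → (lookup L k ≗ F) × (∀ k' → lookup L k' ≗ F → k' ≡ k)

{-# OPTIONS --safe #-}

-- Let m be the last vertex. Its neighbours form a clique, so in an elimination
-- forest of G - m they lie on one path to the root, and m can be inserted at every
-- place of that path: as a leaf below the deepest neighbour, on an edge, or as the
-- root. The rotations involving m move it one place along the path, so each
-- elimination forest of G - m has a fibre that is a path. At either end of a fibre,
-- the other rotations are those of G - m. Hence the greedy rule sweeps m through a
-- whole fibre, makes the next move of the run on G - m, sweeps m back in the
-- opposite direction, and so on; induction on the number of vertices finishes.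
--
-- To keep the vertex set fixed, "G - m" is G with m isolated. Elimination forests
-- are handled through a local description (EF): adjacent vertices are comparable,
-- and the subtree of a non-root vertex contains a neighbour of its parent.
module Submission where

open import Defs
open import Data.Bool using (Bool; true; false)
import Data.Bool.Properties as Bool
open import Data.Fin using (Fin; zero; suc; _<_; _≤_; toℕ; fromℕ<)
open import Data.Fin.Induction using (spo-wellFounded)
open import Data.Fin.Properties using (_≟_; any?; ≤∧≢⇒<; <-cmp; <⇒≢; toℕ-fromℕ<; toℕ<n)
open import Data.Fin.Subset using (Subset; _∈_; _⊆_; _⊃_; _-_; _∪_; ⁅_⁆)
open import Data.Fin.Subset.Induction using (⊃-wellFounded)
open import Data.Fin.Subset.Properties using (_∈?_; ∈⊤; x∈⁅x⁆; x∈⁅y⁆⇒x≡y; p⊆p∪q; x∈p∪q⁺; x∈p∪q⁻; p─q⊆p; x∈p∧x≢y⇒x∈p-y)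
open import Data.List using (List; []; _∷_)
open import Data.List.Membership.Propositional.Properties using (∈-lookup)
import Data.List.Relation.Unary.All as All
open import Data.List.Relation.Unary.All using ([]; _∷_)
open import Data.List.Relation.Unary.All.Properties using (¬Any⇒All¬; All¬⇒¬Any)
open import Data.List.Relation.Unary.AllPairs using (AllPairs; []; _∷_)
import Data.List.Relation.Unary.Any as Any
open import Data.List.Relation.Unary.Any using (Any; here; there)
open import Data.Maybe using (Maybe; just; nothing)
open import Data.Maybe.Properties using (just-injective; ≡-dec)
import Data.Nat as ℕ
import Data.Nat.Properties as ℕ
open import Data.Nat using (ℕ; zero; suc)
open import Data.Product using (∃-syntax; Σ; _×_; _,_; proj₁; proj₂)
open import Data.Sum using (_⊎_; inj₁; inj₂; swap) renaming (map to ⊎-map)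
open import Data.Vec using (_∷_; there)
open import Function using (_∘_; case_of_)
open import Induction.WellFounded using (Acc; acc)
open import Relation.Binary.Construct.Closure.ReflexiveTransitive using (Star; ε; _◅_; _◅◅_)
open import Relation.Binary.Definitions using (tri<; tri≈; tri>)
open import Relation.Binary.PropositionalEquality
open import Relation.Binary.Structures using (IsStrictPartialOrder)
open import Relation.Nullary using (¬_; Dec; yes; no; contradiction)
open import Relation.Nullary.Decidable using (_×-dec_; ¬?; map′)

-- Forests and rotations

module _ {n : ℕ} where

  Below : Forest n → Fin n → Fin n → Set
  Below F = Star (λ v p → F v ≡ just p)

  -- A bare parent function may contain cycles. A finite path to a root excludes them and is what
  -- recursions up a tree descend on.
  data Rooted (F : Forest n) : Fin n → Set where
    root : ∀ {v} → F v ≡ nothing → Rooted F v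
    up   : ∀ {v p} → F v ≡ just p → Rooted F p → Rooted F v

  nothing≢just : ∀ {x : Fin n} {a : Maybe (Fin n)} → a ≡ nothing → a ≢ just x
  nothing≢just refl ()

  parent-unique : ∀ {a : Maybe (Fin n)} {p q} → a ≡ just p → a ≡ just q → p ≡ q
  parent-unique e e′ = just-injective (trans (sym e) e′)

  _≟ᴹ_ : (a b : Maybe (Fin n)) → Dec (a ≡ b)
  _≟ᴹ_ = ≡-dec _≟_

  module _ {F : Forest n} where

    below-linear : ∀ {v a b} → Below F v a → Below F v b → Below F a b ⊎ Below F b a
    below-linear ε q = inj₁ q
    below-linear p@(_ ◅ _) ε = inj₂ p
    below-linear (e ◅ p) (e′ ◅ q) with refl ← parent-unique e e′ = below-linear p q

    below-last : ∀ {v a} → Below F v a → v ≡ a ⊎ (∃[ c ] (Below F v c × F c ≡ just a))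
    below-last ε = inj₁ refl
    below-last (e ◅ p) with below-last p
    ... | inj₁ refl = inj₂ (_ , ε , e)
    ... | inj₂ (c , q , e′) = inj₂ (c , e ◅ q , e′)

    below-root : ∀ {v a} → F v ≡ nothing → Below F v a → v ≡ a
    below-root e ε = refl
    below-root e (e′ ◅ _) = contradiction e′ (nothing≢just e)

    -- A cycle through a vertex also passes through its parent, so it can be pushed up the path
    -- until a root is reached, which has no parent.
    acyclic : ∀ {v p} → Rooted F v → F v ≡ just p → ¬ Below F p v
    acyclic (root e) e′ _ = nothing≢just e e′
    acyclic (up e r) e′ b with refl ← parent-unique e e′ = go b
      where
      go : ¬ Below F _ _
      go ε = acyclic r e ε
      go (e″ ◅ q) = acyclic r e″ (q ◅◅ e ◅ ε)

    below? : ∀ {v} → Rooted F v → ∀ a → Dec (Below F v a)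
    below? {v} r a with v ≟ a
    ... | yes refl = yes ε
    below? (root e) a | no v≢a = no (v≢a ∘ below-root e)
    below? (up e r) a | no v≢a = map′ (e ◅_) tail (below? r a)
      where
      tail : Below F _ a → Below F _ a
      tail ε = contradiction refl v≢a
      tail (e′ ◅ q) with refl ← parent-unique e e′ = q

  below-resp : ∀ {F F′ : Forest n} → F ≗ F′ → ∀ {v a} → Below F v a → Below F′ v a
  below-resp eq ε = ε
  below-resp eq (e ◅ p) = trans (sym (eq _)) e ◅ below-resp eq p

  rooted-resp : ∀ {F F′ : Forest n} → F ≗ F′ → ∀ {v} → Rooted F v → Rooted F′ v
  rooted-resp eq (root e) = root (trans (sym (eq _)) e)
  rooted-resp eq (up e r) = up (trans (sym (eq _)) e) (rooted-resp eq r)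

module _ {n : ℕ} (G : Graph n) where

  adj-sym : ∀ {u v} → Adj G u v → Adj G v u
  adj-sym {u} {v} a = trans (Graph.sym G v u) a

  adj-irrefl : ∀ {v} → ¬ Adj G v v
  adj-irrefl {v} a with () ← trans (sym (Graph.irrefl G v)) a

  Touch : Forest n → Fin n → Fin n → Set
  Touch F v p = ∃[ w ] (Below F w v × Adj G w p)

  record EF (F : Forest n) : Set where
    field
      rooted     : ∀ v → Rooted F v
      comparable : ∀ {u v} → Adj G u v → Below F u v ⊎ Below F v u
      touches    : ∀ {v p} → F v ≡ just p → Touch F v p
  open EF

  -- The component test of `Rot` is replaced by a decidable local one: a child of `j` moves to `i`
  -- exactly when its subtree contains a neighbour of `i`. On forests satisfying `EF` the two
  -- notions agree, by `rot⇒rotation` and `rotation⇒rot`.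
  record Rotation (F : Forest n) (i j : Fin n) (F′ : Forest n) : Set where
    field
      edge : F j ≡ just i
      top  : F′ j ≡ F i
      flip : F′ i ≡ just j
      rest : ∀ {v} → v ≢ i → v ≢ j
           → (F′ v ≡ F v × ¬ (F v ≡ just j × Touch F v i))
           ⊎ (F v ≡ just j × Touch F v i × F′ v ≡ just i)
  open Rotation

  touch-resp : ∀ {F F′} → F ≗ F′ → ∀ {v p} → Touch F v p → Touch F′ v p
  touch-resp eq (w , b , a) = w , below-resp eq b , a

  EF-resp : ∀ {F F′} → F ≗ F′ → EF F → EF F′
  EF-resp eq ef .rooted v = rooted-resp eq (ef .rooted v)
  EF-resp eq ef .comparable a = ⊎-map (below-resp eq) (below-resp eq) (ef .comparable a)
  EF-resp eq ef .touches e = touch-resp eq (ef .touches (trans (eq _) e))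

  rotation-resp : ∀ {F F₁ F′ F₁′ i j} → F ≗ F₁ → F′ ≗ F₁′ → Rotation F i j F′ → Rotation F₁ i j F₁′
  rotation-resp eq eq′ r .edge = trans (sym (eq _)) (r .edge)
  rotation-resp eq eq′ r .top = trans (sym (eq′ _)) (trans (r .top) (eq _))
  rotation-resp eq eq′ r .flip = trans (sym (eq′ _)) (r .flip)
  rotation-resp eq eq′ r .rest v≢i v≢j with r .rest v≢i v≢j
  ... | inj₁ (k , ¬t) = inj₁ (trans (sym (eq′ _)) (trans k (eq _)) ,
          λ (e , t) → ¬t (trans (eq _) e , touch-resp (sym ∘ eq) t))
  ... | inj₂ (e , t , e′) = inj₂ (trans (sym (eq _)) e , touch-resp eq t , trans (sym (eq′ _)) e′)

  rotation-deterministic : ∀ {F i j F′ F″} → Rotation F i j F′ → Rotation F i j F″ → F′ ≗ F″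
  rotation-deterministic {i = i} {j} r s v with v ≟ j
  ... | yes refl = trans (r .top) (sym (s .top))
  ... | no v≢j with v ≟ i
  ... | yes refl = trans (r .flip) (sym (s .flip))
  ... | no v≢i with r .rest v≢i v≢j | s .rest v≢i v≢j
  ... | inj₁ (k , _) | inj₁ (k′ , _) = trans k (sym k′)
  ... | inj₁ (_ , ¬t) | inj₂ (e , t , _) = contradiction (e , t) ¬t
  ... | inj₂ (e , t , _) | inj₁ (_ , ¬t) = contradiction (e , t) ¬t
  ... | inj₂ (_ , _ , e) | inj₂ (_ , _ , e′) = trans e (sym e′)

  module _ {F : Forest n} (ef : EF F) where

    parent-not-below : ∀ {v p} → F v ≡ just p → ¬ Below F p v
    parent-not-below = acyclic (ef .rooted _)

    parent-≢ : ∀ {v p} → F v ≡ just p → v ≢ p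
    parent-≢ e refl = parent-not-below e ε

    siblings-disjoint : ∀ {a b p w} → F a ≡ just p → F b ≡ just p
                      → Below F w a → Below F w b → a ≡ b
    siblings-disjoint ea eb wa wb with below-linear wa wb
    ... | inj₁ ε = refl
    ... | inj₂ ε = refl
    ... | inj₁ (e ◅ q) with refl ← parent-unique ea e = contradiction q (parent-not-below eb)
    ... | inj₂ (e ◅ q) with refl ← parent-unique eb e = contradiction q (parent-not-below ea)

    touch? : ∀ v p → Dec (Touch F v p)
    touch? v p = any? λ w → below? (ef .rooted w) v ×-dec (Graph.E G w p Bool.≟ true)

    -- The promised neighbour of the parent is either `v` itself or lies under a child of `v`, whose
    -- own subtree then contains a neighbour of `v`. Consequently isolated vertices take part in no
    -- rotation.
    child-active : ∀ {v p} → F v ≡ just p → ∃[ u ] Adj G v u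
    child-active e with ef .touches e
    ... | w , b , a with below-last b
    ... | inj₁ refl = _ , a
    ... | inj₂ (c , _ , e′) with ef .touches e′
    ... | w′ , _ , a′ = w′ , adj-sym a′

    parent-active : ∀ {v p} → F v ≡ just p → ∃[ u ] Adj G p u
    parent-active e with ef .touches e
    ... | w , _ , a = w , adj-sym a

    incomparable-siblings : ∀ {u v a b p} → F a ≡ just p → F b ≡ just p → a ≢ b
                          → Below F u a → Below F v b → ¬ Adj G u v
    incomparable-siblings ea eb a≢b ua vb adj with ef .comparable adj
    ... | inj₁ uv = a≢b (siblings-disjoint ea eb ua (uv ◅◅ vb))
    ... | inj₂ vu = a≢b (siblings-disjoint ea eb (vu ◅◅ ua) vb)

    rotate : ∀ {i j} → F j ≡ just i → ∃[ F′ ] Rotation F i j F′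
    rotate {i} {j} ej = F′ , record { edge = ej ; top = top′ ; flip = flip′ ; rest = rest′ }
      where
      i≢j = parent-≢ ej ∘ sym
      moves? : ∀ v → Dec (F v ≡ just j × Touch F v i)
      moves? v = (F v ≟ᴹ just j) ×-dec touch? v i
      F′ : Forest n
      F′ v with v ≟ j | v ≟ i | moves? v
      ... | yes _ | _     | _     = F i
      ... | no _  | yes _ | _     = just j
      ... | no _  | no _  | yes _ = just i
      ... | no _  | no _  | no _  = F v
      top′ : F′ j ≡ F i
      top′ with j ≟ j
      ... | yes _ = refl
      ... | no j≢j = contradiction refl j≢j
      flip′ : F′ i ≡ just j
      flip′ with i ≟ j | i ≟ i
      ... | yes i≡j | _ = contradiction i≡j i≢j
      ... | no _ | yes _ = refl
      ... | no _ | no i≢i = contradiction refl i≢i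
      rest′ : ∀ {v} → v ≢ i → v ≢ j
            → (F′ v ≡ F v × ¬ (F v ≡ just j × Touch F v i))
            ⊎ (F v ≡ just j × Touch F v i × F′ v ≡ just i)
      rest′ {v} v≢i v≢j with v ≟ j | v ≟ i | moves? v
      ... | yes e | _     | _     = contradiction e v≢j
      ... | no _  | yes e | _     = contradiction e v≢i
      ... | no _  | no _  | yes (e , t) = inj₂ (e , t , refl)
      ... | no _  | no _  | no ¬m = inj₁ (refl , ¬m)

  -- The part of a rotation that is visibly invariant under exchanging (F , i) with (F′ , j).
  record PreRotation (F : Forest n) (i j : Fin n) (F′ : Forest n) : Set where
    field
      edge : F j ≡ just i
      top  : F′ j ≡ F i
      flip : F′ i ≡ just j
      rest : ∀ {v} → v ≢ i → v ≢ j → F′ v ≡ F v ⊎ (F v ≡ just j × F′ v ≡ just i)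

  pre : ∀ {F i j F′} → Rotation F i j F′ → PreRotation F i j F′
  pre r = record { edge = r .edge ; top = r .top ; flip = r .flip
                 ; rest = λ v≢i v≢j → ⊎-map proj₁ (λ (e , _ , e′) → e , e′) (r .rest v≢i v≢j) }

  pre-sym : ∀ {F i j F′} → PreRotation F i j F′ → PreRotation F′ j i F
  pre-sym r = record { edge = PreRotation.flip r ; top = sym (PreRotation.top r) ; flip = PreRotation.edge r
                     ; rest = λ v≢j v≢i → ⊎-map sym (λ (e , e′) → e′ , e) (PreRotation.rest r v≢i v≢j) }

  module _ {F F′ : Forest n} {i j : Fin n} (r : PreRotation F i j F′) where
    private module R = PreRotation r

    -- A path upwards changes only where it meets `i` or `j`, and there it can be repaired without
    -- leaving these two vertices, so every other ancestor survives.
    pre-below : ∀ {v a} → a ≢ i → a ≢ j → Below F v a → Below F′ v a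
    pre-below a≢i a≢j ε = ε
    pre-below {v} a≢i a≢j (e ◅ p) with pre-below a≢i a≢j p
    ... | q with v ≟ j
    ... | yes refl with refl ← parent-unique e R.edge = tail q
      where
      tail : Below F′ i _ → Below F′ j _
      tail ε = contradiction refl a≢i
      tail (e′ ◅ q) with refl ← parent-unique R.flip e′ = q
    ... | no v≢j with v ≟ i
    ... | yes refl = R.flip ◅ trans R.top e ◅ q
    ... | no v≢i with R.rest v≢i v≢j
    ... | inj₁ k = trans k e ◅ q
    ... | inj₂ (e′ , f) with refl ← parent-unique e e′ = f ◅ R.flip ◅ q

    pre-below-top : ∀ {v} → Below F v i → Below F′ v j
    pre-below-top ε = R.flip ◅ ε
    pre-below-top {v} (e ◅ p) with pre-below-top p
    ... | q with v ≟ j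
    ... | yes refl = ε
    ... | no v≢j with v ≟ i
    ... | yes refl = R.flip ◅ ε
    ... | no v≢i with R.rest v≢i v≢j
    ... | inj₁ k = trans k e ◅ q
    ... | inj₂ (e′ , f) = f ◅ R.flip ◅ ε

    pre-rooted : ∀ {v} → Rooted F v → Rooted F′ v
    pre-rooted {v} ρ with v ≟ j
    pre-rooted (root e) | yes refl = contradiction R.edge (nothing≢just e)
    pre-rooted (up e ρ) | yes refl with refl ← parent-unique e R.edge with pre-rooted ρ
    ... | root e′ = contradiction R.flip (nothing≢just e′)
    -- In the new forest the path of `i` begins with the edge to `j`; its tail is the path wanted.
    ... | up e′ ρ′ with refl ← parent-unique R.flip e′ = ρ′
    pre-rooted {v} ρ | no v≢j with v ≟ i
    pre-rooted (root e) | no v≢j | yes refl = up R.flip (root (trans R.top e))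
    pre-rooted (up e ρ) | no v≢j | yes refl = up R.flip (up (trans R.top e) (pre-rooted ρ))
    ... | no v≢i with R.rest v≢i v≢j
    pre-rooted (root e) | no v≢j | no v≢i | inj₁ k = root (trans k e)
    pre-rooted (up e ρ) | no v≢j | no v≢i | inj₁ k = up (trans k e) (pre-rooted ρ)
    pre-rooted (root e) | no v≢j | no v≢i | inj₂ (e′ , f) = contradiction e′ (nothing≢just e)
    pre-rooted (up e ρ) | no v≢j | no v≢i | inj₂ (e′ , f)
      with refl ← parent-unique e e′ = up f (up R.flip (pre-rooted ρ))

  module _ {F F′ : Forest n} {i j : Fin n} (ef : EF F) (r : Rotation F i j F′) where

    private
      i≢j : i ≢ j
      i≢j = parent-≢ ef (r .edge) ∘ sym

      below-child : ∀ {v} → F v ≡ just j → v ≢ i × v ≢ j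
      below-child e = (λ { refl → parent-not-below ef e (r .edge ◅ ε) }) , parent-≢ ef e

    -- A vertex that ends under `i` without having moved was a sibling of `j`, and no edge joins
    -- subtrees of siblings, so it stays when rotating back. A vertex that moved was a child of `j`,
    -- so its subtree contains a neighbour of `j` and it moves back.
    rotation-sym : Rotation F′ j i F
    rotation-sym .edge = r .flip
    rotation-sym .top = sym (r .top)
    rotation-sym .flip = r .edge
    rotation-sym .rest v≢j v≢i with r .rest v≢i v≢j
    ... | inj₁ (k , ¬t) = inj₁ (sym k , λ (e , w , b , a) →
            incomparable-siblings ef (trans (sym k) e) (r .edge) v≢j
              (pre-below (pre-sym (pre r)) v≢j v≢i b) ε a)
    ... | inj₂ (e , t , e′) with ef .touches e
    ... | w , b , a = inj₂ (e′ , (w , pre-below (pre r) v≢i v≢j b , a) , e)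

    private
      -- Only descendants of `j` could lose `i` as an ancestor. Such a neighbour of `i`, other than
      -- `j`, lies under a child of `j` that touches `i`, and that child moves along to `i`.
      comparable-parent : ∀ {u} → Adj G u i → Below F u i → Below F′ u i ⊎ Below F′ i u
      comparable-parent a b with below-last b
      ... | inj₁ refl = inj₁ ε
      ... | inj₂ (c , b′ , e) with c ≟ j
      ... | yes refl with below-last b′
      ... | inj₁ refl = inj₂ (r .flip ◅ ε)
      ... | inj₂ (d , b″ , e′) with below-child e′
      ... | d≢i , d≢j with r .rest d≢i d≢j
      ... | inj₁ (_ , ¬t) = contradiction (e′ , _ , b″ , a) ¬t
      ... | inj₂ (_ , _ , f) = inj₁ (pre-below (pre r) d≢i d≢j b″ ◅◅ f ◅ ε)
      comparable-parent a b | inj₂ (c , b′ , e) | no c≢j with r .rest (parent-≢ ef e) c≢j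
      ... | inj₁ (k , _) = inj₁ (pre-below (pre r) (parent-≢ ef e) c≢j b′ ◅◅ trans k e ◅ ε)
      ... | inj₂ (_ , _ , f) = inj₁ (pre-below (pre r) (parent-≢ ef e) c≢j b′ ◅◅ f ◅ ε)

      comparable′ : ∀ {u v} → Adj G u v → Below F u v → Below F′ u v ⊎ Below F′ v u
      comparable′ {u} {v} a b with v ≟ j
      ... | yes refl = inj₁ (pre-below-top (pre r) (b ◅◅ r .edge ◅ ε))
      ... | no v≢j with v ≟ i
      ... | yes refl = comparable-parent a b
      ... | no v≢i = inj₁ (pre-below (pre r) v≢i v≢j b)

      touches′ : ∀ {v p} → F′ v ≡ just p → Touch F′ v p
      touches′ {v} e with v ≟ j
      ... | yes refl with ef .touches (trans (sym (r .top)) e)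
      ... | w , b , a = w , pre-below-top (pre r) b , a
      touches′ {v} e | no v≢j with v ≟ i
      -- Now `i` hangs under `j` and needs a neighbour of `j` below it. Either `j` is adjacent to
      -- `i`, or the neighbour of `i` found below `j` lies under a child of `j` that moves to `i`
      -- and brings its own neighbour of `j` along.
      ... | yes refl with refl ← parent-unique e (r .flip) with ef .touches (r .edge)
      ... | w , b , a with below-last b
      ... | inj₁ refl = i , ε , adj-sym a
      ... | inj₂ (c , b′ , ec) with below-child ec
      ... | c≢i , c≢j with r .rest c≢i c≢j
      ... | inj₁ (_ , ¬t) = contradiction (ec , w , b′ , a) ¬t
      ... | inj₂ (_ , _ , f) with ef .touches ec
      ... | w′ , b″ , a′ = w′ , pre-below (pre r) c≢i c≢j b″ ◅◅ f ◅ ε , a′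
      touches′ {v} e | no v≢j | no v≢i with r .rest v≢i v≢j
      ... | inj₁ (k , _) with ef .touches (trans (sym k) e)
      ... | w , b , a = w , pre-below (pre r) v≢i v≢j b , a
      touches′ {v} e | no v≢j | no v≢i | inj₂ (_ , (w , b , a) , f)
        with refl ← parent-unique e f = w , pre-below (pre r) v≢i v≢j b , a

    rotation-EF : EF F′
    rotation-EF .rooted v = pre-rooted (pre r) (ef .rooted v)
    rotation-EF .comparable a with ef .comparable a
    ... | inj₁ b = comparable′ a b
    ... | inj₂ b = swap (comparable′ (adj-sym a) b)
    rotation-EF .touches = touches′

-- Greedy steps

module _ {n : ℕ} (G : Graph n) where
  open EF
  open Rotation

  reach-start : ∀ {P u v} → Reach G P u v → P u
  reach-start (here p) = p
  reach-start (step p _ _) = p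

  reach-trans : ∀ {P u v w} → Reach G P u v → Reach G P v w → Reach G P u w
  reach-trans (here _) q = q
  reach-trans (step p a r) q = step p a (reach-trans r q)

  reach-sym : ∀ {P u v} → Reach G P u v → Reach G P v u
  reach-sym (here p) = here p
  reach-sym (step p a r) = reach-trans (reach-sym r) (step (reach-start r) (adj-sym G a) (here p))

  reach-mono : ∀ {P Q : Fin n → Set} → (∀ {v} → P v → Q v) → ∀ {u v} → Reach G P u v → Reach G Q u v
  reach-mono f (here p) = here (f p)
  reach-mono f (step p a r) = step (f p) a (reach-mono f r)

  desc⇒below : ∀ {F v a} → Desc G F v a → Below F v a
  desc⇒below refl = ε
  desc⇒below (up e d) = e ◅ desc⇒below d

  below⇒desc : ∀ {F v a} → Below F v a → Desc G F v a
  below⇒desc ε = refl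
  below⇒desc (e ◅ b) = up e (below⇒desc b)

  module _ {F : Forest n} (ef : EF G F) where

    ProperlyBelow : Fin n → Fin n → Set
    ProperlyBelow v a = ∃[ p ] (F v ≡ just p × Below F p a)

    -- On a finite vertex set a strict partial order is well founded, which yields induction from
    -- the leaves upwards.
    properlyBelow-isSPO : IsStrictPartialOrder _≡_ ProperlyBelow
    properlyBelow-isSPO = record
      { isEquivalence = isEquivalence
      ; irrefl = λ { refl (_ , e , b) → parent-not-below G ef e b }
      ; trans = λ { (_ , e , b) (_ , e′ , b′) → _ , e , b ◅◅ e′ ◅ b′ }
      ; <-resp-≈ = (λ { refl x → x }) , (λ { refl x → x })
      }

    -- By induction the subtree of each child is connected, and it contains a neighbour of the
    -- vertex above it.
    subtree-connected : ∀ {u v} → Below F u v → Reach G (λ w → Below F w v) u v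
    subtree-connected {v = v} = go (spo-wellFounded properlyBelow-isSPO v)
      where
      go : ∀ {u v} → Acc ProperlyBelow v → Below F u v → Reach G (λ w → Below F w v) u v
      go (acc rs) b with below-last b
      ... | inj₁ refl = here ε
      ... | inj₂ (c , b′ , e) with ef .touches e
      ... | w , bw , a = reach-trans (inside (reach-trans (conn b′) (reach-sym (conn bw))))
                                     (step (bw ◅◅ e ◅ ε) a (here ε))
        where
        conn : ∀ {x} → Below F x c → Reach G (λ y → Below F y c) x c
        conn = go (rs (_ , e , ε))
        inside : ∀ {x y} → Reach G (λ z → Below F z c) x y → Reach G (λ z → Below F z _) x y
        inside = reach-mono (λ x → x ◅◅ e ◅ ε)

    module _ {i j c : Fin n} (ej : F j ≡ just i) (ec : F c ≡ just j) where

      InRest : Fin n → Set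
      InRest v = Desc G F v i × v ≢ j

      -- The subtree of `c` is connected and avoids `j`, so from any of its vertices one can walk to
      -- the neighbour of `i` and then step to `i`.
      touch⇒sameComp : Touch G F c i → ∀ v → Desc G F v c → Reach G InRest v i
      touch⇒sameComp (w , bw , a) v d =
        reach-trans (reach-mono inRest (reach-trans (subtree-connected (desc⇒below d))
                                                    (reach-sym (subtree-connected bw))))
                    (step (inRest bw) a (here (refl , parent-≢ G ef ej ∘ sym)))
        where
        inRest : ∀ {w} → Below F w c → InRest w
        inRest b = below⇒desc (b ◅◅ ec ◅ ej ◅ ε) , λ { refl → parent-not-below G ef ec b }

      -- A walk in H - j leaves the subtree of c only upwards, hence only to i.
      sameComp⇒touch : (∀ v → Desc G F v c → Reach G InRest v i) → Touch G F c i
      sameComp⇒touch same = go ε (same c refl)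
        where
        go : ∀ {u} → Below F u c → Reach G InRest u i → Touch G F c i
        go b (here _) = contradiction (ej ◅ b) (parent-not-below G ef ec)
        go b (step p a r) with ef .comparable a
        ... | inj₂ b′ = go (b′ ◅◅ b) r
        ... | inj₁ b′ with below-linear b b′
        ... | inj₂ b″ = go b″ r
        ... | inj₁ ε = go ε r
        ... | inj₁ (e ◅ b″) with refl ← parent-unique ec e with b″
        ... | ε = contradiction refl (proj₂ (reach-start r))
        ... | e′ ◅ b‴ with refl ← parent-unique ej e′ with b‴
        ... | ε = _ , b , a
        ... | e″ ◅ b⁗ = contradiction (b⁗ ◅◅ desc⇒below (proj₁ (reach-start r))) (parent-not-below G ef e″)

    rot⇒rotation : ∀ {i j F′} → Rot G F i j F′ → Rotation G F i j F′
    rot⇒rotation {i} {j} (ej , top′ , flip′ , children , others) = record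
      { edge = ej ; top = top′ ; flip = flip′ ; rest = rest′ }
      where
      rest′ : ∀ {v} → v ≢ i → v ≢ j → _
      rest′ {v} v≢i v≢j with F v ≟ᴹ just j
      ... | no ne = inj₁ (others v v≢i v≢j ne , ne ∘ proj₁)
      ... | yes e with touch? G ef v i
      ... | yes t = inj₂ (e , t , proj₁ (children v e) (touch⇒sameComp ej e t))
      ... | no ¬t = inj₁ (trans (proj₂ (children v e) (¬t ∘ sameComp⇒touch ej e)) (sym e) , ¬t ∘ proj₂)

    rotation⇒rot : ∀ {i j F′} → Rotation G F i j F′ → Rot G F i j F′
    rotation⇒rot {i} {j} {F′} r = ej , r .top , r .flip , children , others
      where
      ej = r .edge
      children : ∀ c → F c ≡ just j → _
      children c ec with r .rest (λ { refl → parent-not-below G ef ec (ej ◅ ε) }) (parent-≢ G ef ec)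
      ... | inj₁ (k , ¬m) = (λ s → contradiction (ec , sameComp⇒touch ej ec s) ¬m) , (λ _ → trans k ec)
      ... | inj₂ (_ , t , e′) = (λ _ → e′) , (λ ¬s → contradiction (touch⇒sameComp ej ec t) ¬s)
      others : ∀ v → v ≢ i → v ≢ j → F v ≢ just j → F′ v ≡ F v
      others v v≢i v≢j ne with r .rest v≢i v≢j
      ... | inj₁ (k , _) = k
      ... | inj₂ (e , _) = contradiction e ne

  Move : Forest n → Fin n → Fin n → Forest n → Set
  Move F i j F′ = Rotation G F i j F′ ⊎ Rotation G F j i F′

  -- Maximality of `j` and uniqueness of its partner are merged in `dominant`: any unvisited move
  -- whose larger endpoint is at least `j` uses the very edge between `i` and `j`.
  record Greedy (F : Forest n) (vs : List (Forest n)) (F′ : Forest n) : Set where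
    field
      {i j}    : Fin n
      i<j      : i < j
      move     : Move F i j F′
      new      : Unvisited G (F ∷ vs) F′
      dominant : ∀ {i′ j′ X} → j ≤ j′ → i′ < j′ → Move F i′ j′ X → Unvisited G (F ∷ vs) X
               → j′ ≡ j × i′ ≡ i

  module _ {F : Forest n} (ef : EF G F) where

    move⇒rot : ∀ {i j F′} → Move F i j F′ → Rot G F i j F′ ⊎ Rot G F j i F′
    move⇒rot = ⊎-map (rotation⇒rot ef) (rotation⇒rot ef)

    rot⇒move : ∀ {i j F′} → Rot G F i j F′ ⊎ Rot G F j i F′ → Move F i j F′
    rot⇒move = ⊎-map (rot⇒rotation ef) (rot⇒rotation ef)

    greedy⇒step : ∀ {vs F′} → Greedy F vs F′ → Step G F vs F′
    greedy⇒step g = j , i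
                  , ((i , _ , i<j , move⇒rot move , new) , larger)
                  , (i<j , move⇒rot move , new)
                  , λ i′ X (i′<j , m , u) → proj₂ (dominant ℕ.≤-refl i′<j (rot⇒move m) u)
      where
      open Greedy g
      larger : ∀ j′ → j < j′ → ¬ HasMove G _ F j′
      larger j′ j<j′ (i′ , X , i′<j′ , m , u)
        with refl ← proj₁ (dominant (ℕ.<⇒≤ j<j′) i′<j′ (rot⇒move m) u) = ℕ.<-irrefl refl j<j′

    step⇒greedy : ∀ {vs F′} → Step G F vs F′ → Greedy F vs F′
    step⇒greedy {vs} (j , i , (_ , larger) , (i<j , m , new) , unique) = record
      { i<j = i<j ; move = rot⇒move m ; new = new ; dominant = dom }
      where
      dom : ∀ {i′ j′ X} → j ≤ j′ → i′ < j′ → Move F i′ j′ X → Unvisited G (F ∷ vs) X → j′ ≡ j × i′ ≡ i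
      dom {i′} {j′} {X} j≤j′ i′<j′ m′ u with j ≟ j′
      ... | yes refl = refl , unique i′ X (i′<j′ , move⇒rot m′ , u)
      ... | no j≢j′ = contradiction (i′ , X , i′<j′ , move⇒rot m′ , u) (larger j′ (≤∧≢⇒< j≤j′ j≢j′))

  move-EF : ∀ {F i j F′} → EF G F → Move F i j F′ → EF G F′
  move-EF ef (inj₁ r) = rotation-EF G ef r
  move-EF ef (inj₂ r) = rotation-EF G ef r

  move-resp : ∀ {F F₁ F′ F₁′ i j} → F ≗ F₁ → F′ ≗ F₁′ → Move F i j F′ → Move F₁ i j F₁′
  move-resp eq eq′ = ⊎-map (rotation-resp G eq eq′) (rotation-resp G eq eq′)

  run-EF : ∀ {F₀ F vs} → EF G F₀ → Run G F₀ F vs → EF G F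
  run-EF ef start = ef
  run-EF ef (step r s) = move-EF ef′ (Greedy.move (step⇒greedy ef′ s))
    where ef′ = run-EF ef r

-- Deleting the last vertex

module _ {n : ℕ} (m : Fin n) where

  isolate : Graph n → Graph n
  isolate G = record { E = E′ ; sym = sym′ ; irrefl = irrefl′ }
    where
    open Graph G
    E′ : Fin n → Fin n → Bool
    E′ u v with u ≟ m | v ≟ m
    ... | no _  | no _  = E u v
    ... | no _  | yes _ = false
    ... | yes _ | _     = false
    sym′ : ∀ u v → E′ u v ≡ E′ v u
    sym′ u v with u ≟ m | v ≟ m
    ... | no _  | no _  = Graph.sym G u v
    ... | no _  | yes _ = refl
    ... | yes _ | no _  = refl
    ... | yes _ | yes _ = refl
    irrefl′ : ∀ v → E′ v v ≡ false
    irrefl′ v with v ≟ m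
    ... | no _  = irrefl v
    ... | yes _ = refl

  isolate-adj⁻ : ∀ G {u v} → Adj (isolate G) u v → Adj G u v × u ≢ m × v ≢ m
  isolate-adj⁻ G {u} {v} a with u ≟ m | v ≟ m
  ... | no u≢m | no v≢m = a , u≢m , v≢m
  isolate-adj⁻ G () | no _  | yes _
  isolate-adj⁻ G () | yes _ | _

  isolate-adj⁺ : ∀ G {u v} → u ≢ m → v ≢ m → Adj G u v → Adj (isolate G) u v
  isolate-adj⁺ G {u} {v} u≢m v≢m a with u ≟ m | v ≟ m
  ... | no _ | no _ = a
  ... | no _ | yes v≡m = contradiction v≡m v≢m
  ... | yes u≡m | _ = contradiction u≡m u≢m

  isolate-peo : ∀ G → PerfectElimOrdering G → PerfectElimOrdering (isolate G)
  isolate-peo G peo v u w u<v w<v uv wv u≢w with isolate-adj⁻ G uv | isolate-adj⁻ G wv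
  ... | uv′ , u≢m , _ | wv′ , w≢m , _ = isolate-adj⁺ G u≢m w≢m (peo v u w u<v w<v uv′ wv′ u≢w)

  -- Abstract, so that matching on v ≟ m does not unfold del in goals.
  abstract
    del : Forest n → Forest n
    del F v with v ≟ m | F v ≟ᴹ just m
    ... | yes _ | _     = nothing
    ... | no _  | yes _ = F m
    ... | no _  | no _  = F v

  data DelView (F : Forest n) (v : Fin n) : Set where
    self  : v ≡ m → del F v ≡ nothing → DelView F v
    child : v ≢ m → F v ≡ just m → del F v ≡ F m → DelView F v
    other : v ≢ m → F v ≢ just m → del F v ≡ F v → DelView F v

  abstract
    delView : ∀ F v → DelView F v
    delView F v with v ≟ m in eq₁ | F v ≟ᴹ just m in eq₂
    ... | yes v≡m | _     = self v≡m (lem eq₁)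
      where
      lem : ∀ {p} → (v ≟ m) ≡ yes p → del F v ≡ nothing
      lem e rewrite e = refl
    ... | no v≢m  | yes e = child v≢m e (lem eq₁ eq₂)
      where
      lem : ∀ {p q} → (v ≟ m) ≡ no p → (F v ≟ᴹ just m) ≡ yes q → del F v ≡ F m
      lem e e′ rewrite e | e′ = refl
    ... | no v≢m  | no ne = other v≢m ne (lem eq₁ eq₂)
      where
      lem : ∀ {p q} → (v ≟ m) ≡ no p → (F v ≟ᴹ just m) ≡ no q → del F v ≡ F v
      lem e e′ rewrite e | e′ = refl

  del-self : ∀ F → del F m ≡ nothing
  del-self F with delView F m
  ... | self _ e = e
  ... | child m≢m _ _ = contradiction refl m≢m
  ... | other m≢m _ _ = contradiction refl m≢m

  del-child : ∀ F {v} → v ≢ m → F v ≡ just m → del F v ≡ F m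
  del-child F {v} v≢m e with delView F v
  ... | self v≡m _ = contradiction v≡m v≢m
  ... | child _ _ d = d
  ... | other _ ne _ = contradiction e ne

  del-other : ∀ F {v} → v ≢ m → F v ≢ just m → del F v ≡ F v
  del-other F {v} v≢m ne with delView F v
  ... | self v≡m _ = contradiction v≡m v≢m
  ... | child _ e _ = contradiction e ne
  ... | other _ _ d = d

  del-parent : ∀ F {v p} → v ≢ m → p ≢ m → F v ≡ just p → del F v ≡ just p
  del-parent F v≢m p≢m e = trans (del-other F v≢m λ e′ → p≢m (parent-unique e e′)) e

  del-resp : ∀ {F F′} → F ≗ F′ → del F ≗ del F′
  del-resp {F} {F′} eq v with delView F v
  ... | self refl d = trans d (sym (del-self F′))
  ... | child v≢m e d = trans d (trans (eq m) (sym (del-child F′ v≢m (trans (sym (eq v)) e))))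
  ... | other v≢m ne d = trans d (trans (eq v) (sym (del-other F′ v≢m (ne ∘ trans (eq v)))))

  del-below⁻ : ∀ F {v a} → Below (del F) v a → Below F v a
  del-below⁻ F ε = ε
  del-below⁻ F {v} (e ◅ b) with delView F v
  ... | self _ d = contradiction e (nothing≢just d)
  ... | child _ e′ d = e′ ◅ trans (sym d) e ◅ del-below⁻ F b
  ... | other _ _ d = trans (sym d) e ◅ del-below⁻ F b

  del-below⁺ : ∀ F {v a} → v ≢ m → a ≢ m → Below F v a → Below (del F) v a
  del-below-child : ∀ F {v a} → v ≢ m → a ≢ m → F v ≡ just m → Below F m a → Below (del F) v a

  del-below⁺ F v≢m a≢m ε = ε
  del-below⁺ F v≢m a≢m (_◅_ {j = w} e b) with w ≟ m
  ... | no w≢m = del-parent F v≢m w≢m e ◅ del-below⁺ F w≢m a≢m b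
  ... | yes refl = del-below-child F v≢m a≢m e b

  del-below-child F v≢m a≢m e ε = contradiction refl a≢m
  del-below-child F v≢m a≢m e (_◅_ {j = w} e′ b) with w ≟ m
  ... | no w≢m = trans (del-child F v≢m e) e′ ◅ del-below⁺ F w≢m a≢m b
  -- Acyclicity is not assumed here, so `m` may be its own parent and the path may stay at `m`.
  ... | yes refl = del-below-child F v≢m a≢m e b

  del-rooted : ∀ F {v} → Rooted F v → Rooted (del F) v
  del-rooted F {v} ρ with delView F v
  ... | self _ d = root d
  del-rooted F (root e) | child _ e′ d = contradiction e′ (nothing≢just e)
  del-rooted F (up e (root e″)) | child _ e′ d with refl ← parent-unique e e′ = root (trans d e″)
  del-rooted F (up e (up e″ ρ)) | child _ e′ d with refl ← parent-unique e e′ = up (trans d e″) (del-rooted F ρ)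
  del-rooted F (root e) | other _ _ d = root (trans d e)
  del-rooted F (up e ρ) | other _ _ d = up (trans d e) (del-rooted F ρ)

  -- These are the two ends of a fibre. In an elimination forest both hold at once exactly when `m`
  -- has no neighbours, and then the fibre is a single forest.
  Bottom Top : Forest n → Set
  Bottom F = ∀ {v} → F v ≢ just m
  Top F = F m ≡ nothing

-- Fibres of the deletion of a simplicial vertex

module Fibre {n : ℕ} (G : Graph n) (peo : PerfectElimOrdering G) (m : Fin n)
             (isolated : ∀ {v u} → m < v → ¬ Adj G v u) where
  open EF
  open Rotation

  G′ : Graph n
  G′ = isolate m G

  active-≤ : ∀ {v u} → Adj G v u → v ≢ m → v < m
  active-≤ {v} a v≢m with <-cmp v m
  ... | tri< v<m _ _ = v<m
  ... | tri≈ _ v≡m _ = contradiction v≡m v≢m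
  ... | tri> _ _ m<v = contradiction a (isolated m<v)

  -- All vertices above `m` are isolated, so every neighbour of `m` is smaller than `m` and the
  -- clique condition at `m` covers its whole neighbourhood.
  neighbours-adjacent : ∀ {u w} → Adj G u m → Adj G w m → u ≢ w → Adj G u w
  neighbours-adjacent um wm u≢w =
    peo m _ _ (active-≤ um λ { refl → adj-irrefl G um }) (active-≤ wm λ { refl → adj-irrefl G wm }) um wm u≢w

  module _ {F : Forest n} (ef : EF G F) where

    -- The subtrees of two children each contain a neighbour of `m`. These neighbours are equal or
    -- adjacent, but distinct siblings have disjoint subtrees with no edge between them.
    child-unique : ∀ {a b} → F a ≡ just m → F b ≡ just m → a ≡ b
    child-unique {a} {b} ea eb with ef .touches ea | ef .touches eb
    ... | u , ua , um | w , wb , wm with u ≟ w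
    ... | yes refl = siblings-disjoint G ef ea eb ua wb
    ... | no u≢w with a ≟ b
    ... | yes a≡b = a≡b
    ... | no a≢b = contradiction (neighbours-adjacent um wm u≢w)
                                 (incomparable-siblings G ef ea eb a≢b ua wb)

    -- A neighbour of `i` below `m` lies under the only child of `m`, or is `m` itself. In the
    -- latter case `i` is a neighbour of `m`, hence adjacent to the neighbour of `m` below `v`.
    grandchild-touches : ∀ {i v} → F m ≡ just i → F v ≡ just m → Touch G F v i
    grandchild-touches em ev with ef .touches em
    ... | w , b , a with below-last b
    ... | inj₂ (c , b′ , ec) with refl ← child-unique ec ev = w , b′ , a
    ... | inj₁ refl with ef .touches ev
    ... | u , bu , um = u , bu , neighbours-adjacent um (adj-sym G a)
                                   λ { refl → parent-not-below G ef em (bu ◅◅ ev ◅ ε) }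

    -- This supplies a substitute for `m` as a witness once `m` is deleted: either the parent of `m`
    -- is a neighbour, or `m` has a child, whose subtree contains one.
    neighbour-below : ∀ {v} → v ≢ m → Below F m v → ∃[ w ] (Below F w v × Adj G w m × w ≢ m)
    neighbour-below v≢m ε = contradiction refl v≢m
    neighbour-below v≢m (e ◅ b) with ef .touches e
    ... | w , bw , a with below-last bw
    ... | inj₁ refl = _ , b , adj-sym G a , parent-≢ G ef e ∘ sym
    ... | inj₂ (c , _ , ec) with ef .touches ec
    ... | u , bu , um = u , bu ◅◅ ec ◅ e ◅ b , um , λ { refl → adj-irrefl G um }

    del-touch⁻ : ∀ {v p} → Touch G′ (del m F) v p → Touch G F v p
    del-touch⁻ (w , b , a) = w , del-below⁻ m F b , proj₁ (isolate-adj⁻ m G a)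

    -- If the witness is `m`, a neighbour of `m` below `v` replaces it: it and `p` both lie in the
    -- clique around `m`, and they differ because `p` is not below `v`.
    del-touch⁺ : ∀ {v p} → v ≢ m → p ≢ m → ¬ Below F p v → Touch G F v p → Touch G′ (del m F) v p
    del-touch⁺ v≢m p≢m ¬pv (w , b , a) with w ≟ m
    ... | no w≢m = w , del-below⁺ m F w≢m v≢m b , isolate-adj⁺ m G w≢m p≢m a
    ... | yes refl with neighbour-below v≢m b
    ... | u , bu , um , u≢m = u , del-below⁺ m F u≢m v≢m bu
        , isolate-adj⁺ m G u≢m p≢m (neighbours-adjacent um (adj-sym G a) λ { refl → ¬pv bu })

    del-EF : EF G′ (del m F)
    del-EF .rooted v = del-rooted m F (ef .rooted v)
    del-EF .comparable a with isolate-adj⁻ m G a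
    ... | a′ , u≢m , v≢m = ⊎-map (del-below⁺ m F u≢m v≢m) (del-below⁺ m F v≢m u≢m) (ef .comparable a′)
    del-EF .touches {v} {p} e with delView m F v
    ... | self _ d = contradiction e (nothing≢just d)
    ... | child v≢m e′ d = del-touch⁺ v≢m (parent-≢ G ef em ∘ sym)
                             (λ b → parent-not-below G ef em (b ◅◅ e′ ◅ ε))
                             (grandchild-touches em e′)
      where em = trans (sym d) e
    ... | other v≢m ne d = del-touch⁺ v≢m (λ { refl → ne e′ }) (parent-not-below G ef e′) (ef .touches e′)
      where e′ = trans (sym d) e

    -- Since m is simplicial, its at most one child follows the parent of m.
    del-up : ∀ {i F′} → Rotation G F i m F′ → del m F′ ≗ del m F
    del-up {i} {F′} r v with v ≟ m
    ... | yes refl = trans (del-self m F′) (sym (del-self m F))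
    ... | no v≢m with v ≟ i
    ... | yes refl = trans (del-child m F′ v≢m (r .flip))
                      (trans (r .top) (sym (del-other m F v≢m λ e → parent-not-below G ef e (r .edge ◅ ε))))
    ... | no v≢i with r .rest v≢i v≢m
    ... | inj₁ (k , ¬t) = trans (del-other m F′ v≢m (ne ∘ trans (sym k))) (trans k (sym (del-other m F v≢m ne)))
      where
      ne : F v ≢ just m
      ne e = ¬t (e , grandchild-touches (r .edge) e)
    ... | inj₂ (e , _ , e′) = trans (del-parent m F′ v≢m (parent-≢ G ef (r .edge) ∘ sym) e′)
                                    (trans (sym (r .edge)) (sym (del-child m F v≢m e)))

  del-move : ∀ {i F F′} → EF G F → Move G F i m F′ → del m F′ ≗ del m F
  del-move ef (inj₁ r) = del-up ef r
  del-move ef (inj₂ r) v = sym (del-up (rotation-EF G ef r) (rotation-sym G ef r) v)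

  Extreme : Forest n → Set
  Extreme F = Bottom m F ⊎ Top m F

  module _ {F F′ : Forest n} {i j : Fin n} (ef : EF G F) (i≢m : i ≢ m) (j≢m : j ≢ m)
           (r : Rotation G F i j F′) where

    rotation-Top : Top m F → Top m F′
    rotation-Top t with r .rest (i≢m ∘ sym) (j≢m ∘ sym)
    ... | inj₁ (k , _) = trans k t
    ... | inj₂ (e , _) = contradiction e (nothing≢just t)

    rotation-Bottom : Bottom m F → Bottom m F′
    rotation-Bottom bot {v} e with v ≟ j
    ... | yes refl = bot (trans (sym (r .top)) e)
    ... | no v≢j with v ≟ i
    ... | yes refl = j≢m (parent-unique (r .flip) e)
    ... | no v≢i with r .rest v≢i v≢j
    ... | inj₁ (k , _) = bot (trans (sym k) e)
    ... | inj₂ (_ , _ , f) = i≢m (parent-unique f e)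

    del-rotation : Extreme F → Rotation G′ (del m F) i j (del m F′)
    del-rotation ext = record
      { edge = del-parent m F j≢m i≢m (r .edge)
      ; top = top′ ext
      ; flip = del-parent m F′ i≢m j≢m (r .flip)
      ; rest = rest′ ext
      }
      where
      top′ : Extreme F → del m F′ j ≡ del m F i
      top′ (inj₁ bot) = trans (del-other m F′ j≢m (rotation-Bottom bot))
                              (trans (r .top) (sym (del-other m F i≢m bot)))
      top′ (inj₂ t) with delView m F i
      ... | self i≡m _ = contradiction i≡m i≢m
      ... | child _ e d = trans (del-child m F′ j≢m (trans (r .top) e))
                                (trans (rotation-Top t) (sym (trans d t)))
      ... | other _ ne d = trans (del-other m F′ j≢m (ne ∘ trans (sym (r .top)))) (trans (r .top) (sym d))
      rest′ : Extreme F → ∀ {v} → v ≢ i → v ≢ j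
            → (del m F′ v ≡ del m F v × ¬ (del m F v ≡ just j × Touch G′ (del m F) v i))
            ⊎ (del m F v ≡ just j × Touch G′ (del m F) v i × del m F′ v ≡ just i)
      rest′ ext {v} v≢i v≢j with delView m F v
      ... | self refl d = inj₁ (trans (del-self m F′) (sym d) , λ (e , _) → nothing≢just d e)
      rest′ (inj₁ bot) v≢i v≢j | child _ e _ = contradiction e bot
      rest′ (inj₂ t) v≢i v≢j | child v≢m e d with r .rest v≢i v≢j
      ... | inj₁ (k , _) = inj₁ ( trans (del-child m F′ v≢m (trans k e)) (trans (rotation-Top t) (sym (trans d t)))
                                , λ (e′ , _) → nothing≢just (trans d t) e′)
      ... | inj₂ (e′ , _) = contradiction (parent-unique e′ e) j≢m
      rest′ ext v≢i v≢j | other v≢m ne d with r .rest v≢i v≢j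
      ... | inj₁ (k , ¬t) = inj₁ ( trans (del-other m F′ v≢m (ne ∘ trans (sym k))) (trans k (sym d))
                                 , λ (e , t) → ¬t (trans (sym d) e , del-touch⁻ ef t))
      ... | inj₂ (e , t , f) = inj₂ ( trans d e
                                    , del-touch⁺ ef v≢m i≢m (λ b → parent-not-below G ef e (r .edge ◅ b)) t
                                    , del-parent m F′ v≢m i≢m f)

  del-move-other : ∀ {F F′ i j} → EF G F → Extreme F → i ≢ m → j ≢ m
                 → Move G F i j F′ → Move G′ (del m F) i j (del m F′)
  del-move-other ef ext i≢m j≢m (inj₁ r) = inj₁ (del-rotation ef i≢m j≢m r ext)
  del-move-other ef ext i≢m j≢m (inj₂ r) = inj₂ (del-rotation ef j≢m i≢m r ext)

  -- Deletion creates an edge only by joining a child of `m` to the parent of `m`; at an end of the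
  -- fibre one of the two is missing. This is what allows every move of the smaller forest to be
  -- lifted.
  Extreme-edge : ∀ {F i j} → Extreme F → del m F j ≡ just i → F j ≡ just i
  Extreme-edge {F} {i} {j} ext e with delView m F j | ext
  ... | self _ d | _ = contradiction e (nothing≢just d)
  ... | child _ e′ _ | inj₁ bot = contradiction e′ bot
  ... | child _ _ d | inj₂ t = contradiction e (nothing≢just (trans d t))
  ... | other _ _ d | _ = trans (sym d) e

  lift-rotation : ∀ {F F′ i j} → EF G F → Extreme F → i ≢ m → j ≢ m → Rotation G′ (del m F) i j F′
                → ∃[ X ] (Rotation G F i j X × del m X ≗ F′)
  lift-rotation ef ext i≢m j≢m r with rotate G ef (Extreme-edge ext (r .edge))
  ... | X , r′ = X , r′ , rotation-deterministic G′ (del-rotation ef i≢m j≢m r′ ext) r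

  lift-move : ∀ {F F′ i j} → EF G F → Extreme F → i ≢ m → j ≢ m → Move G′ (del m F) i j F′
            → ∃[ X ] (Move G F i j X × del m X ≗ F′)
  lift-move ef ext i≢m j≢m (inj₁ r) with lift-rotation ef ext i≢m j≢m r
  ... | X , r′ , eq = X , inj₁ r′ , eq
  lift-move ef ext i≢m j≢m (inj₂ r) with lift-rotation ef ext j≢m i≢m r
  ... | X , r′ , eq = X , inj₂ r′ , eq

  move-Top : ∀ {F F′ i j} → EF G F → i ≢ m → j ≢ m → Move G F i j F′ → Top m F → Top m F′
  move-Top ef i≢m j≢m (inj₁ r) = rotation-Top ef i≢m j≢m r
  move-Top ef i≢m j≢m (inj₂ r) = rotation-Top ef j≢m i≢m r

  move-Bottom : ∀ {F F′ i j} → EF G F → i ≢ m → j ≢ m → Move G F i j F′ → Bottom m F → Bottom m F′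
  move-Bottom ef i≢m j≢m (inj₁ r) = rotation-Bottom ef i≢m j≢m r
  move-Bottom ef i≢m j≢m (inj₂ r) = rotation-Bottom ef j≢m i≢m r

  -- The subtree of `v` contains a neighbour `w` of `m`, which in `Y` lies under some child `c` of
  -- the root `m`. After deletion both `v` and `c` are roots above `w` in the same forest, so they
  -- coincide.
  Top-child : ∀ {X Y} → EF G X → EF G Y → Top m X → Top m Y → del m X ≗ del m Y
            → ∀ {v} → X v ≡ just m → Y v ≡ just m
  Top-child {X} {Y} efX efY tX tY eq {v} ev with efX .touches ev
  ... | w , b , a with efY .comparable a
  ... | inj₂ b′ with refl ← below-root tY b′ = contradiction a (adj-irrefl G)
  ... | inj₁ b′ with below-last b′
  ... | inj₁ refl = contradiction a (adj-irrefl G)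
  ... | inj₂ (c , b″ , ec) = subst (λ x → Y x ≡ just m) (roots-agree (below-linear bX bY)) ec
    where
    w≢m : w ≢ m
    w≢m refl = adj-irrefl G a
    v≢m = parent-≢ G efX ev
    c≢m = parent-≢ G efY ec
    bX : Below (del m X) w v
    bX = del-below⁺ m X w≢m v≢m b
    bY : Below (del m X) w c
    bY = below-resp (sym ∘ eq) (del-below⁺ m Y w≢m c≢m b″)
    v-root : del m X v ≡ nothing
    v-root = trans (del-child m X v≢m ev) tX
    c-root : del m X c ≡ nothing
    c-root = trans (eq c) (trans (del-child m Y c≢m ec) tY)
    roots-agree : Below (del m X) v c ⊎ Below (del m X) c v → c ≡ v
    roots-agree (inj₁ p) = sym (below-root v-root p)
    roots-agree (inj₂ p) = below-root c-root p

  Top-unique : ∀ {X Y} → EF G X → EF G Y → Top m X → Top m Y → del m X ≗ del m Y → X ≗ Y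
  Top-unique {X} {Y} efX efY tX tY eq v with delView m X v | delView m Y v
  ... | self refl _ | _ = trans tX (sym tY)
  ... | _ | self refl _ = trans tX (sym tY)
  ... | child _ e _ | _ = trans e (sym (Top-child efX efY tX tY eq e))
  ... | _ | child _ e _ = trans (Top-child efY efX tY tX (sym ∘ eq) e) (sym e)
  ... | other _ _ d | other _ _ d′ = trans (sym d) (trans (eq v) d′)

-- Sweeping through the fibres

module _ {n : ℕ} where

  ≗-sym : {F F′ : Forest n} → F ≗ F′ → F′ ≗ F
  ≗-sym e v = sym (e v)

  ≗-trans : {F F′ F″ : Forest n} → F ≗ F′ → F′ ≗ F″ → F ≗ F″
  ≗-trans e e′ v = trans (e v) (e′ v)

  Visited : List (Forest n) → Forest n → Set
  Visited L X = Any (_≗ X) L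

  visited-resp : ∀ {L X Y} → X ≗ Y → Visited L X → Visited L Y
  visited-resp e = Any.map λ e′ → ≗-trans e′ e

  OnPath : ∀ {T : Forest n → Forest n → Set} {X Z} → Star T X Z → Forest n → Set
  OnPath {X = X} ε W = X ≗ W
  OnPath {X = X} (_ ◅ p) W = X ≗ W ⊎ OnPath p W

  module _ {T : Forest n → Forest n → Set} where

    onPath-start : ∀ {X Z W} (p : Star T X Z) → X ≗ W → OnPath p W
    onPath-start ε e = e
    onPath-start (_ ◅ _) e = inj₁ e

    onPath-end : ∀ {X Z W} (p : Star T X Z) → Z ≗ W → OnPath p W
    onPath-end ε e = e
    onPath-end (_ ◅ p) e = inj₂ (onPath-end p e)

    onPath-++ˡ : ∀ {X Y Z W} (p : Star T X Y) (q : Star T Y Z) → OnPath p W → OnPath (p ◅◅ q) W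
    onPath-++ˡ ε q e = onPath-start q e
    onPath-++ˡ (_ ◅ p) q (inj₁ e) = inj₁ e
    onPath-++ˡ (_ ◅ p) q (inj₂ o) = inj₂ (onPath-++ˡ p q o)

  length-to-root : ∀ {F : Forest n} {v} → Rooted F v → ℕ
  length-to-root (root _) = 0
  length-to-root (up _ ρ) = suc (length-to-root ρ)

  module _ {F : Forest n} (rooted : ∀ v → Rooted F v) where

    -- The argument is meant to be the parent of `m`, measured in a fixed forest over which the
    -- fibre lies. Depth 0 is the position of `m` as a root, so the depth locates `m` within its
    -- fibre.
    depth : Maybe (Fin n) → ℕ
    depth nothing = 0
    depth (just v) = suc (length-to-root (rooted v))

    length-irrelevant : ∀ {v} (ρ ρ′ : Rooted F v) → length-to-root ρ ≡ length-to-root ρ′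
    length-irrelevant (root _) (root _) = refl
    length-irrelevant (root e) (up e′ _) = contradiction e′ (nothing≢just e)
    length-irrelevant (up e _) (root e′) = contradiction e (nothing≢just e′)
    length-irrelevant (up e ρ) (up e′ ρ′) with refl ← parent-unique e e′ = cong suc (length-irrelevant ρ ρ′)

    depth-parent : ∀ v → depth (F v) ℕ.< depth (just v)
    depth-parent v with F v in e
    ... | nothing = ℕ.s≤s ℕ.z≤n
    ... | just p = ℕ.s≤s (ℕ.≤-reflexive (length-irrelevant (up e (rooted p)) (rooted v)))

module _ {n : ℕ} (G : Graph n) (peo : PerfectElimOrdering G) (m : Fin n)
             (isolated : ∀ {v u} → m < v → ¬ Adj G v u) where
  open EF
  open Rotation
  open Fibre G peo m isolated

  Up Down : Forest n → Fin n → Forest n → Set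
  Up X a Y = Rotation G X a m Y
  Down X a Y = Rotation G X m a Y

  UpChain DownChain : Forest n → Forest n → Set
  UpChain = Star (λ X Y → ∃[ a ] Up X a Y)
  DownChain = Star (λ X Y → ∃[ a ] Down X a Y)

  module _ {X Y : Forest n} {a : Fin n} (ef : EF G X) (r : Up X a Y) where

    -- The forest `H` below the fibre stays fixed, so an up-rotation takes the parent of `m` one
    -- step up in `H`.
    up-parent : ∀ {H} → del m X ≗ H → Y m ≡ H a
    up-parent eq = trans (r .top) (trans (sym (del-other m X a≢m ne)) (eq a))
      where
      a≢m : a ≢ m
      a≢m = parent-≢ G ef (r .edge) ∘ sym
      ne : X a ≢ just m
      ne e = parent-not-below G ef e (r .edge ◅ ε)

    up-depth : ∀ {H} (ρ : ∀ v → Rooted H v) → del m X ≗ H → depth ρ (Y m) ℕ.< depth ρ (X m)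
    up-depth ρ eq rewrite up-parent eq | r .edge = depth-parent ρ a

  -- An up-rotation makes its old parent a child of `m`. Since `m` has at most one child, the result
  -- determines the edge to rotate back, and with it the origin.
  up-injective : ∀ {X X′ Y Y′ a a′} → EF G X → EF G X′ → Up X a Y → Up X′ a′ Y′ → Y ≗ Y′ → X ≗ X′
  up-injective {Y′ = Y′} ef ef′ r r′ eq
    with refl ← child-unique (rotation-EF G ef′ r′) (trans (sym (eq _)) (r .flip)) (r′ .flip) =
    rotation-deterministic G (rotation-resp G eq (λ _ → refl) (rotation-sym G ef r)) (rotation-sym G ef′ r′)

  chain-EF : ∀ {X T} → EF G X → UpChain X T → EF G T
  chain-EF ef ε = ef
  chain-EF ef ((_ , r) ◅ c) = chain-EF (rotation-EF G ef r) c

  chain-del : ∀ {X T} → EF G X → UpChain X T → del m T ≗ del m X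
  chain-del ef ε _ = refl
  chain-del ef ((_ , r) ◅ c) = ≗-trans (chain-del (rotation-EF G ef r) c) (del-up ef r)

  -- Up-rotations of `m` do not change the forest without `m`, so the recursion follows the path
  -- from the parent of `m` to the root in that fixed forest.
  ascend : ∀ {X} → EF G X → ∃[ T ] (UpChain X T × Top m T)
  ascend {X} ef with X m in e
  ... | nothing = X , ε , e
  ... | just i = go ef (λ _ → refl) e (del-EF ef .rooted i)
    where
    go : ∀ {Y i} → EF G Y → del m Y ≗ del m X → Y m ≡ just i → Rooted (del m X) i
       → ∃[ T ] (UpChain Y T × Top m T)
    go ef eq e ρ with rotate G ef e
    ... | Z , r with ρ
    ... | root e′ = Z , (_ , r) ◅ ε , trans (up-parent ef r eq) e′
    ... | up e′ ρ′ with go (rotation-EF G ef r) (≗-trans (del-up ef r) eq) (trans (up-parent ef r eq) e′) ρ′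
    ... | T , c , t = T , (_ , r) ◅ c , t

  onPath-predecessor : ∀ {B T X Y a} → EF G B → EF G X → (c : UpChain B T) → Up X a Y → OnPath c Y
                     → B ≗ Y ⊎ OnPath c X
  onPath-predecessor efB efX ε r o = inj₁ o
  onPath-predecessor efB efX (_ ◅ c) r (inj₁ e) = inj₁ e
  onPath-predecessor efB efX ((_ , r′) ◅ c) r (inj₂ o)
    with onPath-predecessor (rotation-EF G efB r′) efX c r o
  ... | inj₁ e = inj₂ (inj₁ (up-injective efB efX r′ r e))
  ... | inj₂ o′ = inj₂ (inj₂ o′)

  -- Two chains with the same top are compared backwards. Predecessors are unique, so the second
  -- chain stays on the first. It cannot pass beyond `B`, since the result of an up-rotation has a
  -- child of `m`.
  chain-merge : ∀ {B T X T′} → EF G B → Bottom m B → (c : UpChain B T) → EF G X → UpChain X T′ → T ≗ T′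
              → OnPath c X
  chain-merge efB bot c efX ε eq = onPath-end c eq
  chain-merge efB bot c efX ((_ , r) ◅ d) eq
    with onPath-predecessor efB efX c r (chain-merge efB bot c (rotation-EF G efX r) d eq)
  ... | inj₁ e = contradiction (trans (e _) (r .flip)) bot
  ... | inj₂ o = o

  -- Any forest of the fibre ascends to a top forest, and the fibre has only one; merging the chains
  -- shows that the chain from bottom to top is the whole fibre.
  chain-covers : ∀ {B T X} → EF G B → Bottom m B → (c : UpChain B T) → Top m T
               → EF G X → del m X ≗ del m B → OnPath c X
  chain-covers efB bot c t efX eq with ascend efX
  ... | T′ , d , t′ = chain-merge efB bot c efX d
        (Top-unique (chain-EF efB c) (chain-EF efX d) t t′
          (≗-trans (chain-del efB c) (≗-sym (≗-trans (chain-del efX d) eq))))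

  reverse-chain : ∀ {B T} → EF G B → (c : UpChain B T)
                → Σ (DownChain T B) λ d → ∀ {W} → OnPath c W → OnPath d W
  reverse-chain ef ε = ε , λ o → o
  reverse-chain {B} ef ((a , r) ◅ c) with reverse-chain (rotation-EF G ef r) c
  ... | d , on = d ◅◅ last , on′
    where
    last : DownChain _ B
    last = (a , rotation-sym G ef r) ◅ ε
    on′ : ∀ {W} → OnPath ((a , r) ◅ c) W → OnPath (d ◅◅ last) W
    on′ (inj₁ e) = onPath-end (d ◅◅ last) e
    on′ (inj₂ o) = onPath-++ˡ d last (on o)

  module _ {F : Forest n} {i j : Fin n} {F′ : Forest n} (ef : EF G F) where

    move-active : Move G F i j F′ → (∃[ u ] Adj G i u) × (∃[ u ] Adj G j u)
    move-active (inj₁ r) = parent-active G ef (r .edge) , child-active G ef (r .edge)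
    move-active (inj₂ r) = child-active G ef (r .edge) , parent-active G ef (r .edge)

    move-≢ : Move G F i j F′ → i ≢ j
    move-≢ (inj₁ r) = parent-≢ G ef (r .edge) ∘ sym
    move-≢ (inj₂ r) = parent-≢ G ef (r .edge)

  -- ≺ compares the positions of m, given by its parent, in the direction of the sweep.
  record Direction (H : Forest n) : Set₁ where
    field
      R         : Forest n → Fin n → Forest n → Set
      _≺_       : Maybe (Fin n) → Maybe (Fin n) → Set
      R⇒move    : ∀ {X a Y} → R X a Y → Move G X a m Y
      move⇒R    : ∀ {X a Y} → EF G X → Move G X a m Y → R X a Y ⊎ R Y a X
      R-edge    : ∀ {X a Y b Z} → EF G X → R X a Y → R X b Z → a ≡ b
      R-inj     : ∀ {X a Y b Z} → EF G X → EF G Z → R X a Y → R Z b Y → X ≗ Z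
      ≺-trans   : ∀ {a b c} → a ≺ b → b ≺ c → a ≺ c
      ≺-irrefl  : ∀ {a} → ¬ (a ≺ a)
      R-advance : ∀ {X a Y} → EF G X → del m X ≗ H → R X a Y → X m ≺ Y m

  module _ {H : Forest n} (ρ : ∀ v → Rooted H v) where

    upwards : Direction H
    upwards = record
      { R = Up
      ; _≺_ = λ a b → depth ρ b ℕ.< depth ρ a
      ; R⇒move = inj₁
      ; move⇒R = λ { ef (inj₁ r) → inj₁ r ; ef (inj₂ r) → inj₂ (rotation-sym G ef r) }
      ; R-edge = λ _ r s → parent-unique (r .edge) (s .edge)
      ; R-inj = λ ef ef′ r s → up-injective ef ef′ r s (λ _ → refl)
      ; ≺-trans = λ p q → ℕ.<-trans q p
      ; ≺-irrefl = ℕ.<-irrefl refl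
      ; R-advance = λ ef eq r → up-depth ef r ρ eq
      }

    downwards : Direction H
    downwards = record
      { R = Down
      ; _≺_ = λ a b → depth ρ a ℕ.< depth ρ b
      ; R⇒move = inj₂
      ; move⇒R = λ { ef (inj₁ r) → inj₂ (rotation-sym G ef r) ; ef (inj₂ r) → inj₁ r }
      ; R-edge = λ ef r s → child-unique ef (r .edge) (s .edge)
      ; R-inj = inj
      ; ≺-trans = ℕ.<-trans
      ; ≺-irrefl = ℕ.<-irrefl refl
      ; R-advance = λ ef eq r → up-depth (rotation-EF G ef r) (rotation-sym G ef r) ρ
                                  (≗-trans (≗-sym (del-up (rotation-EF G ef r) (rotation-sym G ef r))) eq)
      }
      where
      inj : ∀ {X a Y b Z} → EF G X → EF G Z → Down X a Y → Down Z b Y → X ≗ Z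
      inj ef ef′ r s with rotation-sym G ef r | rotation-sym G ef′ s
      ... | r′ | s′ with refl ← parent-unique (r′ .edge) (s′ .edge) = rotation-deterministic G r′ s′

  module _ {H F₀ : Forest n} (D : Direction H) where
    open Direction D

    record Walked (X Z : Forest n) (vs : List (Forest n)) (p : Star (λ X Y → ∃[ a ] R X a Y) X Z) : Set where
      field
        {seen}   : List (Forest n)
        run      : Run G F₀ Z seen
        extends  : ∀ {W} → Visited (X ∷ vs) W → Visited (Z ∷ seen) W
        contains : ∀ {W} → OnPath p W → Visited (Z ∷ seen) W
        only     : ∀ {W} → Visited (Z ∷ seen) W → Visited (X ∷ vs) W ⊎ del m W ≗ H

    -- The two last hypotheses say that a backward move from `X` leads to a visited forest, and that
    -- nothing visited in this fibre lies further ahead. Vertices above `m` are isolated, so `m` is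
    -- the largest candidate and moving it forward is its only new move. Both hypotheses persist
    -- after each step.
    walk : ∀ {X Z vs} (p : Star (λ X Y → ∃[ a ] R X a Y) X Z) → EF G X → del m X ≗ H → Run G F₀ X vs
         → (∀ {W a} → EF G W → R W a X → Visited (X ∷ vs) W)
         → (∀ {W} → Visited (X ∷ vs) W → del m W ≗ H → ¬ (X m ≺ W m))
         → Walked X Z vs p
    walk ε ef eq runX back behind = record
      { run = runX ; extends = λ v → v ; contains = here ; only = inj₁ }
    walk {X} {vs = vs} ((a , r) ◅ p) ef eq runX back behind = record
      { run = run w
      ; extends = extends w ∘ there
      ; contains = λ { (inj₁ e) → extends w (there (here e)) ; (inj₂ o) → contains w o }
      ; only = λ v → case only w v of λ where
          (inj₁ (here e)) → inj₂ (≗-trans (del-resp m (≗-sym e)) eqY)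
          (inj₁ (there v′)) → inj₁ v′
          (inj₂ e) → inj₂ e
      }
      where
      open Walked
      mv = R⇒move r
      efY = move-EF G ef mv
      eqY = ≗-trans (del-move ef mv) eq
      advance = R-advance ef eq r
      new : Unvisited G (X ∷ vs) _
      new = ¬Any⇒All¬ _ λ v → behind v eqY advance
      dominant : ∀ {i′ j′ Z} → m ≤ j′ → i′ < j′ → Move G X i′ j′ Z → Unvisited G (X ∷ vs) Z → j′ ≡ m × i′ ≡ a
      dominant {j′ = j′} m≤j′ _ mv′ u with m ≟ j′
      ... | no m≢j′ = contradiction (proj₂ (proj₂ (move-active ef mv′))) (isolated (≤∧≢⇒< m≤j′ m≢j′))
      ... | yes refl with move⇒R ef mv′
      ... | inj₁ r′ = refl , R-edge ef r′ r
      ... | inj₂ r′ = contradiction (back (move-EF G ef mv′) r′) (All¬⇒¬Any u)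
      greedy : Greedy G X vs _
      greedy = record
        { i<j = active-≤ (proj₂ (proj₁ (move-active ef mv))) (move-≢ ef mv)
        ; move = mv ; new = new ; dominant = dominant }
      behind′ : ∀ {W} → Visited (_ ∷ X ∷ vs) W → del m W ≗ H → ¬ (_ ≺ W m)
      behind′ (here e) eqW lt rewrite e m = ≺-irrefl lt
      behind′ (there v) eqW lt = behind v eqW (≺-trans advance lt)
      w = walk p efY eqY (step runX (greedy⇒step G ef greedy))
            (λ efW r′ → there (here (R-inj ef efW r r′))) behind′

  module _ {F₀ : Forest n} where

    -- The invariant after a completed sweep: the visited forests are the full fibres over the
    -- forests visited in the smaller graph, and the run stands at one end of the latest fibre. Both
    -- ends are kept, because `end` decides the direction of the next sweep.
    record Lifted (F′ : Forest n) (vs′ : List (Forest n)) : Set where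
      field
        {F B T}  : Forest n
        {seen}   : List (Forest n)
        run      : Run G F₀ F seen
        efB      : EF G B
        bottom   : Bottom m B
        top      : Top m T
        chain    : UpChain B T
        over     : del m B ≗ F′
        end      : F ≡ B ⊎ F ≡ T
        complete : ∀ {X} → EF G X → Visited (F′ ∷ vs′) (del m X) → Visited (F ∷ seen) X
        sound    : ∀ {X} → Visited (F ∷ seen) X → Visited (F′ ∷ vs′) (del m X)

    module _ {H B T : Forest n} {vs vs′ : List (Forest n)}
             (ρ : ∀ v → Rooted H v)
             (efB : EF G B) (bottom : Bottom m B) (top : Top m T) (chain : UpChain B T) (over : del m B ≗ H)
             (complete : ∀ {X} → EF G X → Visited vs′ (del m X) → Visited vs X)
             (sound : ∀ {X} → Visited vs X → Visited vs′ (del m X))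
             (fresh : ¬ Visited vs′ H) where

      private
        overT : del m T ≗ H
        overT = ≗-trans (chain-del efB chain) over

        behind : ∀ (D : Direction H) {X W}
               → Visited (X ∷ vs) W → del m W ≗ H → ¬ Direction._≺_ D (X m) (W m)
        behind D (here e) _ lt rewrite e m = Direction.≺-irrefl D lt
        behind D (there v) eq _ = fresh (visited-resp eq (sound v))

        lifted : ∀ {X Z} (D : Direction H) {p : Star (λ X Y → ∃[ a ] Direction.R D X a Y) X Z}
               → del m X ≗ H → (∀ {W} → OnPath chain W → OnPath p W) → Z ≡ B ⊎ Z ≡ T
               → Walked {F₀ = F₀} D X Z vs p → Lifted H vs′
        lifted {X} {Z} D overX on end w = record
          { run = W.run ; efB = efB ; bottom = bottom ; top = top ; chain = chain ; over = over ; end = end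
          ; complete = complete′ ; sound = sound′ }
          where
          module W = Walked w
          complete′ : ∀ {X} → EF G X → Visited (H ∷ vs′) (del m X) → Visited (Z ∷ W.seen) X
          complete′ ef (here e) = W.contains (on (chain-covers efB bottom chain top ef (≗-sym (≗-trans over e))))
          complete′ ef (there v) = W.extends (there (complete ef v))
          sound′ : ∀ {Y} → Visited (Z ∷ W.seen) Y → Visited (H ∷ vs′) (del m Y)
          sound′ v with W.only v
          ... | inj₁ (here e) = here (≗-trans (≗-sym overX) (del-resp m e))
          ... | inj₁ (there v′) = there (sound v′)
          ... | inj₂ e = here (≗-sym e)

      sweep-up : Run G F₀ B vs → Lifted H vs′
      -- No backward move leads to the start: an up-rotation ending in `B` would give `m` a child.
      sweep-up run = lifted (upwards ρ) over (λ o → o) (inj₂ refl)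
        (walk (upwards ρ) chain efB over run (λ _ r → contradiction (r .flip) bottom) (behind (upwards ρ)))

      sweep-down : Run G F₀ T vs → Lifted H vs′
      sweep-down run with reverse-chain efB chain
      -- Dually, a down-rotation ending in `T` would give `m` a parent.
      ... | d , on = lifted (downwards ρ) overT on (inj₁ refl)
        (walk (downwards ρ) d (chain-EF efB chain) overT run
          (λ _ r → contradiction (r .flip) (nothing≢just top)) (behind (downwards ρ)))

    -- The whole current fibre has been visited, so no move of `m` is new, and vertices above `m` do
    -- not move. The remaining moves project to moves of the smaller forest, and being new is
    -- preserved both ways by `complete` and `sound`.
    lift-greedy : ∀ {F seen F′ vs′ F″ X} → EF G F → Extreme F → del m F ≗ F′
      → (∀ {Y} → EF G Y → Visited (F′ ∷ vs′) (del m Y) → Visited (F ∷ seen) Y)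
      → (∀ {Y} → Visited (F ∷ seen) Y → Visited (F′ ∷ vs′) (del m Y))
      → (g : Greedy G′ F′ vs′ F″)
      → Greedy.j g < m → Move G F (Greedy.i g) (Greedy.j g) X → del m X ≗ F″ → Greedy G F seen X
    lift-greedy {F} {seen} {F′} {vs′} ef ext over complete sound g j<m mv overX = record
      { i<j = i<j
      ; move = mv
      ; new = ¬Any⇒All¬ _ λ v → All¬⇒¬Any new (visited-resp overX (sound v))
      ; dominant = dominant′
      }
      where
      open Greedy g
      dominant′ : ∀ {i′ j′ Y} → j ≤ j′ → i′ < j′ → Move G F i′ j′ Y → Unvisited G (F ∷ seen) Y
                → j′ ≡ j × i′ ≡ i
      dominant′ {j′ = j′} j≤j′ i′<j′ mv′ u with <-cmp j′ m
      ... | tri> _ _ m<j′ = contradiction (proj₂ (proj₂ (move-active ef mv′))) (isolated m<j′)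
      ... | tri≈ _ refl _ = contradiction
              (complete (move-EF G ef mv′) (here (≗-sym (≗-trans (del-move ef mv′) over))))
              (All¬⇒¬Any u)
      ... | tri< j′<m j′≢m _ = dominant j≤j′ i′<j′
              (move-resp G′ over (λ _ → refl)
                (del-move-other ef ext (<⇒≢ (ℕ.<-trans i′<j′ j′<m)) j′≢m mv′))
              (¬Any⇒All¬ _ λ v → All¬⇒¬Any u (complete (move-EF G ef mv′) v))

    lift-step : ∀ {F′ vs′ F″} → Lifted F′ vs′ → Step G′ F′ vs′ F″ → Lifted F″ (F′ ∷ vs′)
    lift-step {F′} {vs′} {F″} L s = go L.end
      where
      module L = Lifted L
      ef′ : EF G′ F′
      ef′ = EF-resp G′ L.over (del-EF L.efB)
      g = step⇒greedy G′ ef′ s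
      open Greedy g
      ρ : ∀ v → Rooted F″ v
      ρ = move-EF G′ ef′ move .rooted
      efT = chain-EF L.efB L.chain
      overT : del m L.T ≗ F′
      overT = ≗-trans (chain-del L.efB L.chain) L.over
      j-active : ∃[ u ] Adj G′ j u
      j-active = active ef′ move
        where
        active : EF G′ F′ → Move G′ F′ i j F″ → ∃[ u ] Adj G′ j u
        active ef (inj₁ r) = child-active G′ ef (r .edge)
        active ef (inj₂ r) = parent-active G′ ef (r .edge)
      j≢m : j ≢ m
      j≢m = proj₁ (proj₂ (isolate-adj⁻ m G (proj₂ j-active)))
      j<m : j < m
      j<m = active-≤ (proj₁ (isolate-adj⁻ m G (proj₂ j-active))) j≢m
      i≢m : i ≢ m
      i≢m = <⇒≢ (ℕ.<-trans i<j j<m)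
      lift : ∀ {X} → EF G X → Extreme X → del m X ≗ F′ → ∃[ Y ] (Move G X i j Y × del m Y ≗ F″)
      lift ef ext eq = lift-move ef ext i≢m j≢m (move-resp G′ (≗-sym eq) (λ _ → refl) move)

      go : L.F ≡ L.B ⊎ L.F ≡ L.T → Lifted F″ (F′ ∷ vs′)
      -- The next fibre is always described from its bottom, reached from the old bottom by the
      -- lifted move. If the run stands at the old top, lifting the same move there reaches the top
      -- of this fibre, since tops are unique.
      go at with lift L.efB (inj₁ L.bottom) L.over
      ... | B₂ , mvB , overB₂ with move-EF G L.efB mvB | move-Bottom L.efB i≢m j≢m mvB L.bottom
      ... | efB₂ | bottom₂ with ascend efB₂
      ... | T₂ , chain₂ , top₂ with at
      ... | inj₁ refl = sweep-up ρ efB₂ bottom₂ top₂ chain₂ overB₂ L.complete L.sound (All¬⇒¬Any new)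
              (step L.run (greedy⇒step G L.efB
                (lift-greedy L.efB (inj₁ L.bottom) L.over L.complete L.sound g j<m mvB overB₂)))
      ... | inj₂ refl with lift efT (inj₂ L.top) overT
      ... | T₂′ , mvT , overT₂′ = sweep-down ρ efB₂ bottom₂ top₂ chain₂ overB₂ L.complete L.sound (All¬⇒¬Any new)
              (step L.run (greedy⇒step G efT
                (lift-greedy efT (inj₂ L.top) overT L.complete L.sound g j<m
                  (move-resp G (λ _ → refl) same mvT) overT₂)))
        where
        overT₂ : del m T₂ ≗ F″
        overT₂ = ≗-trans (chain-del efB₂ chain₂) overB₂
        same : T₂′ ≗ T₂
        same = Top-unique (move-EF G efT mvT) (chain-EF efB₂ chain₂)
                 (move-Top efT i≢m j≢m mvT L.top) top₂ (≗-trans overT₂′ (≗-sym overT₂))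

    lift-run : EF G F₀ → Bottom m F₀ → ∀ {F′ vs′} → Run G′ (del m F₀) F′ vs′ → Lifted F′ vs′
    lift-run ef bottom start with ascend ef
    ... | T , chain , top = sweep-up (del-EF ef .rooted) ef bottom top chain (λ _ → refl)
                              (λ _ ()) (λ ()) (λ ()) start
    lift-run ef bottom (step r s) = lift-step (lift-run ef bottom r) s

-- Induction on the number of non-isolated vertices

module _ {n : ℕ} where

  -- This property of the initial forest survives deletion and places it at the bottom of its fibre
  -- at every level of the induction.
  Increasing : Forest n → Set
  Increasing F = ∀ {v p} → F v ≡ just p → p < v

  -- Only vertices with index below `k` may have neighbours, and the last of them is deleted. With
  -- `k` zero there are no edges, so the only elimination forest consists of roots.
  traverse : ∀ k → k ℕ.≤ n → (G : Graph n) → PerfectElimOrdering G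
           → (∀ {v u} → k ℕ.≤ toℕ v → ¬ Adj G v u)
           → ∀ {F₀} → EF G F₀ → Increasing F₀
           → ∃[ F ] ∃[ vs ] (Run G F₀ F vs × (∀ {X} → EF G X → Visited (F ∷ vs) X))
  traverse zero _ G _ isolated {F₀} ef₀ _ =
    F₀ , [] , start , λ ef → here λ v → trans (is-root ef₀ v) (sym (is-root ef v))
    where
    is-root : ∀ {X} → EF G X → ∀ v → X v ≡ nothing
    is-root {X} ef v with X v in e
    ... | nothing = refl
    ... | just p = contradiction (proj₂ (child-active G ef e)) (isolated ℕ.z≤n)
  traverse (suc k) k<n G peo isolated {F₀} ef₀ inc = result
    where
    m : Fin n
    m = fromℕ< k<n
    m≡k : toℕ m ≡ k
    m≡k = toℕ-fromℕ< k<n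
    isolated-above : ∀ {v u} → m < v → ¬ Adj G v u
    isolated-above m<v = isolated (subst (ℕ._< _) m≡k m<v)
    open Fibre G peo m isolated-above using (G′; del-EF)
    isolated′ : ∀ {v u} → k ℕ.≤ toℕ v → ¬ Adj G′ v u
    isolated′ k≤v a with isolate-adj⁻ m G a
    ... | a′ , v≢m , _ = isolated-above
            (≤∧≢⇒< (subst (ℕ._≤ _) (sym m≡k) k≤v) (v≢m ∘ sym)) a′
    bottom : Bottom m F₀
    -- A child of `m` would be larger than `m` and hence isolated, but a vertex with a parent has a
    -- neighbour.
    bottom e = isolated-above (inc e) (proj₂ (child-active G ef₀ e))
    inc′ : Increasing (del m F₀)
    inc′ {v} e with delView m F₀ v
    ... | self _ d = contradiction e (nothing≢just d)
    ... | child _ e′ _ = contradiction e′ bottom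
    ... | other _ _ d = inc (trans (sym d) e)
    result : ∃[ F ] ∃[ vs ] (Run G F₀ F vs × (∀ {X} → EF G X → Visited (F ∷ vs) X))
    result with traverse k (ℕ.<⇒≤ k<n) G′ (isolate-peo m G peo) isolated′ (del-EF ef₀) inc′
    ... | F′ , vs′ , run′ , all′ = L.F , L.seen , L.run , λ ef → L.complete ef (all′ (del-EF ef))
      where module L = Lifted (lift-run G peo m isolated-above ef₀ bottom run′)

  module _ (G : Graph n) where

    run-distinct : ∀ {F₀ F vs} → Run G F₀ F vs → AllPairs (λ F F′ → ¬ (F′ ≗ F)) (F ∷ vs)
    run-distinct start = [] ∷ []
    run-distinct (step r (_ , _ , _ , (_ , _ , new) , _)) = new ∷ run-distinct r

    visited-once : ∀ {L X} → AllPairs (λ F F′ → ¬ (F′ ≗ F)) L → Visited L X → VisitedExactlyOnce G L X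
    visited-once {L = _ ∷ L} (new ∷ _) (here e) = zero , e , λ where
      zero _ → refl
      (suc k) e′ → contradiction (≗-trans e′ (≗-sym e)) (All.lookup new (∈-lookup k))
    visited-once {L = _ ∷ L} (new ∷ distinct) (there v) with visited-once distinct v
    ... | k , e , unique = suc k , e , λ where
      zero e′ → contradiction (≗-trans e (≗-sym e′)) (All.lookup new (∈-lookup k))
      (suc k′) e′ → cong suc (unique k′ e′)

-- Components and the recursive definition of elimination forests

∈-delete⁻ : ∀ {n} {p : Subset n} {x y} → x ∈ p - y → x ∈ p
∈-delete⁻ = p─q⊆p _ _

∈-delete-≢ : ∀ {n} {p : Subset n} {x y} → x ∈ p - y → x ≢ y
∈-delete-≢ {p = true ∷ p} {y = zero} () refl
∈-delete-≢ {p = false ∷ p} {y = zero} () refl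
∈-delete-≢ {p = _ ∷ p} {y = suc y} (there x∈) refl = ∈-delete-≢ {p = p} {y = y} x∈ refl

module _ {n : ℕ} (G : Graph n) where

  -- Starting from the single vertex `v`, an adjacent vertex of `S` is added as long as one is
  -- missing; sets can grow only finitely often.
  component : ∀ {S v} → v ∈ S → ∃[ C ] (IsComponent G S C × v ∈ C)
  component {S} {v} v∈S = grow ⁅ v ⁆ (⊃-wellFounded ⁅ v ⁆)
    (λ u∈ → subst (_∈ S) (sym (x∈⁅y⁆⇒x≡y v u∈)) v∈S) (x∈⁅x⁆ v)
    (λ {u} u∈ → subst (Reach G (_∈ S) v) (sym (x∈⁅y⁆⇒x≡y v u∈)) (here v∈S))
    where
    grow : ∀ C → Acc _⊃_ C → C ⊆ S → v ∈ C → (∀ {u} → u ∈ C → Reach G (_∈ S) v u)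
         → ∃[ C ] (IsComponent G S C × v ∈ C)
    grow C (acc rs) C⊆S v∈C reach
      with any? (λ u → (u ∈? C) ×-dec
             any? (λ w → (w ∈? S) ×-dec ¬? (w ∈? C) ×-dec (Graph.E G u w Bool.≟ true)))
    ... | yes (u , u∈C , w , w∈S , w∉C , a) =
      grow (C ∪ ⁅ w ⁆) (rs (p⊆p∪q ⁅ w ⁆ , w , x∈p∪q⁺ (inj₂ (x∈⁅x⁆ w)) , w∉C))
           (λ x∈ → subset (x∈p∪q⁻ C ⁅ w ⁆ x∈)) (p⊆p∪q ⁅ w ⁆ v∈C)
           (λ x∈ → reach′ (x∈p∪q⁻ C ⁅ w ⁆ x∈))
      where
      subset : ∀ {x} → x ∈ C ⊎ x ∈ ⁅ w ⁆ → x ∈ S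
      subset (inj₁ x∈C) = C⊆S x∈C
      subset (inj₂ x∈w) with refl ← x∈⁅y⁆⇒x≡y w x∈w = w∈S
      reach′ : ∀ {x} → x ∈ C ⊎ x ∈ ⁅ w ⁆ → Reach G (_∈ S) v x
      reach′ (inj₁ x∈C) = reach x∈C
      reach′ (inj₂ x∈w) with refl ← x∈⁅y⁆⇒x≡y w x∈w =
        reach-trans G (reach u∈C) (step (C⊆S u∈C) a (here w∈S))
    ... | no none = C , (C⊆S , (v , v∈C) , connected , closed) , v∈C
      where
      connected : ∀ u w → u ∈ C → w ∈ C → Reach G (_∈ S) u w
      connected u w u∈C w∈C = reach-trans G (reach-sym G (reach u∈C)) (reach w∈C)
      closed : ∀ u w → u ∈ C → w ∈ S → Adj G u w → w ∈ C
      closed u w u∈C w∈S a with w ∈? C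
      ... | yes w∈C = w∈C
      ... | no w∉C = contradiction (u , u∈C , w , w∈S , w∉C , a) none

  -- Walk from the component to the deleted root x; the last step enters x.
  component-touches : ∀ {S C D x} → IsComponent G S C → x ∈ C → IsComponent G (C - x) D
                    → ∃[ w ] (w ∈ D × Adj G w x)
  component-touches {S} {C} {D} {x} (_ , _ , connected , closed) x∈C (D⊆ , (v , v∈D) , _ , closedD) =
    go v∈D (connected v x (∈-delete⁻ (D⊆ v∈D)) x∈C)
    where
    go : ∀ {u} → u ∈ D → Reach G (_∈ S) u x → ∃[ w ] (w ∈ D × Adj G w x)
    go u∈D (here _) = contradiction refl (∈-delete-≢ (D⊆ u∈D))
    go {u} u∈D (step {w = w} _ a r) with w ≟ x
    ... | yes refl = u , u∈D , a
    ... | no w≢x = go (closedD u w u∈D (x∈p∧x≢y⇒x∈p-y w∈C w≢x) a) r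
      where w∈C = closed u w (∈-delete⁻ (D⊆ u∈D)) (reach-start G r) a

  module _ {F : Forest n} where

    isEF-root : ∀ {S q v} → IsEF G F S q → v ∈ S → ∃[ r ] (Below F v r × F r ≡ q)
    isEF-root {v = v} (node f) v∈S with component v∈S
    ... | C , isC , v∈C with f C isC
    ... | x , _ , ex , sub with v ≟ x
    ... | yes refl = x , ε , ex
    ... | no v≢x with isEF-root sub (x∈p∧x≢y⇒x∈p-y v∈C v≢x)
    ... | r , b , er = x , b ◅◅ er ◅ ε , ex

    isEF-below : ∀ {C x v} → IsEF G F (C - x) (just x) → v ∈ C → Below F v x
    isEF-below {x = x} {v} sub v∈C with v ≟ x
    ... | yes refl = ε
    ... | no v≢x with isEF-root sub (x∈p∧x≢y⇒x∈p-y v∈C v≢x)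
    ... | r , b , er = b ◅◅ er ◅ ε

    -- Adjacent vertices stay in a common component until one of them is its root, and then the
    -- other lies below it.
    isEF-comparable : ∀ {S q u v} → IsEF G F S q → u ∈ S → v ∈ S → Adj G u v → Below F u v ⊎ Below F v u
    isEF-comparable {u = u} {v} (node f) u∈S v∈S a with component u∈S
    ... | C , isC@(_ , _ , _ , closed) , u∈C with f C isC | closed u v u∈C v∈S a
    ... | x , _ , _ , sub | v∈C with u ≟ x | v ≟ x
    ... | yes refl | _ = inj₂ (isEF-below sub v∈C)
    ... | no _ | yes refl = inj₁ (isEF-below sub u∈C)
    ... | no u≢x | no v≢x = isEF-comparable sub (x∈p∧x≢y⇒x∈p-y u∈C u≢x) (x∈p∧x≢y⇒x∈p-y v∈C v≢x) a

    -- The recursion carries the fact that every component has a neighbour of `q`, the vertex above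
    -- its root. At the outermost level there is no such vertex; below, `component-touches` provides
    -- it.
    isEF-touches : ∀ {S q v p} → IsEF G F S q
                 → (∀ {p C} → q ≡ just p → IsComponent G S C → ∃[ w ] (w ∈ C × Adj G w p))
                 → v ∈ S → F v ≡ just p → Touch G F v p
    isEF-touches {v = v} (node f) roots v∈S e with component v∈S
    ... | C , isC , v∈C with f C isC
    ... | x , x∈C , ex , sub with v ≟ x
    ... | no v≢x = isEF-touches sub (λ { refl → component-touches isC x∈C }) (x∈p∧x≢y⇒x∈p-y v∈C v≢x) e
    ... | yes refl with roots (trans (sym ex) e) isC
    ... | w , w∈C , a = w , isEF-below sub w∈C , a

    below-root-rooted : ∀ {v r} → Below F v r → F r ≡ nothing → Rooted F v
    below-root-rooted ε e = root e
    below-root-rooted (e′ ◅ b) e = up e′ (below-root-rooted b e)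

    elimForest⇒EF : ElimForest G F → EF G F
    elimForest⇒EF ef = record
      { rooted = λ v → let r , b , e = isEF-root ef ∈⊤ in below-root-rooted b e
      ; comparable = isEF-comparable ef ∈⊤ ∈⊤
      ; touches = isEF-touches ef (λ ()) ∈⊤
      }

    byOrder⇒isEF : ∀ {rank S q} → ByOrder G rank F S q → IsEF G F S q
    byOrder⇒isEF (node f) = node λ C isC →
      let x , x∈C , _ , e , sub = f C isC in x , x∈C , e , byOrder⇒isEF sub

    -- Each root is the least vertex of its component, so it lies below everything that remains
    -- after its removal.
    byOrder-increasing : ∀ {S q v p} → ByOrder G toℕ F S q → (∀ {p u} → q ≡ just p → u ∈ S → p < u)
                       → v ∈ S → F v ≡ just p → p < v
    byOrder-increasing {v = v} (node f) above v∈S e with component v∈S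
    ... | C , isC@(C⊆S , _) , v∈C with f C isC
    ... | x , x∈C , least , ex , sub with v ≟ x
    ... | yes refl = above (trans (sym ex) e) v∈S
    ... | no v≢x = byOrder-increasing sub
            (λ { refl u∈ → ≤∧≢⇒< (least _ (∈-delete⁻ u∈)) (∈-delete-≢ u∈ ∘ sym) })
            (x∈p∧x≢y⇒x∈p-y v∈C v≢x) e

theorem1 : ∀ (n : ℕ) (G : Graph n) → Chordal G → PerfectElimOrdering G
    → ∀ (F₀ : Forest n) → ForestOfOrdering G toℕ F₀
    → ∃[ F ] ∃[ vs ] (Run G F₀ F vs × Halts G F vs
    × (∀ F' → ElimForest G F' → VisitedExactlyOnce G (F ∷ vs) F'))
theorem1 n G _ peo F₀ ord
  with elimForest⇒EF G (byOrder⇒isEF G ord)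
... | ef₀ with traverse n ℕ.≤-refl G peo (λ {v} n≤v _ → ℕ.<⇒≱ (toℕ<n v) n≤v) ef₀
                 (byOrder-increasing G ord (λ ()) ∈⊤)
... | F , vs , run , all = F , vs , run , inj₁ halts
                         , λ F′ ef → visited-once G (run-distinct G run) (all (elimForest⇒EF G ef))
  where
  halts : ∀ j → ¬ HasMove G (F ∷ vs) F j
  -- A rotation of `F` gives an elimination forest again, and all of these have been visited.
  halts j (_ , X , _ , rot , new) =
    All¬⇒¬Any new (all (move-EF G ef (rot⇒move G ef rot)))
    where ef = run-EF G ef₀ run
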